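{- Let $n\ge1$ and $(\pi,u)\in\operatorname{Vert}(C_n)$. Then $\operatorname{dinv}'_C(\pi,u)=\operatorname{area}'(\zeta_C(\pi),d_C(\pi,u))$.
   Context: $\mathcal L_{n,n}$: words in $\{N,E\}$ with $n$ of each letter; $\mathcal B_{2n}$: words of length $2n$ whose prefixes have at least as many $N$'s as $E$'s. Rise $i$: the $i$-th $N$ is immediately followed by $N$. Valley $(i,j)$: the $i$-th $E$ is immediately followed by the $j$-th $N$; also $(i,j+1)$ if a ballot path with $i$ East and $j$ North steps ends with an East step. For $a\in\mathbb Z^n$, $j\ge0$: $\overrightarrow{S}^+_j(a)$ reads $a$ left to right writing $N$ for entries $j$ and $E$ for entries $j+1$; $\overleftarrow{S}^+_j(a)$ reads right to left; $\overrightarrow{S}^-_j,\overleftarrow{S}^-_j$ likewise with $N$ for $-j$, $E$ for $-j-1$. $\mathfrak S_n^C$: bijections $u$ of $\{\pm1,\dots,\pm n\}$ with $u(-i)=-u(i)$, acting on $\mathbb R^n$ by $u\cdot e_i=e_{u(i)}$, $e_{ -i}=-e_i$. For $\pi\in\mathcal L_{n,n}$: $\lambda_i$ = number of $E$'s before the $i$-th $N$; $\mu_i=(n+1-i)-\lambda_{n+1-i}$; $\zeta_C(\pi)=\overleftarrow{S}^-_n(\mu)\overrightarrow{S}^+_n(\mu)\cdots\overleftarrow{S}^-_0(\mu)\overrightarrow{S}^+_0(\mu)$. $\operatorname{Vert}(C_n)$: pairs $(\pi,u)$, $u\in\mathfrak S_n^C$, $u(i)<u(i+1)$ for each rise $i$,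 $u(1)>0$ if $\pi$ begins with $N$. $d_C(\pi,u)\in\mathfrak S_n^C$: for $i=0,\dots,n$ write $-u(j)$ for $j$ with $\mu_{n+1-j}=-i$ in decreasing order of $j$, then $u(j)$ for $j$ with $\mu_{n+1-j}=i+1$ in increasing order of $j$; this sequence is the window. Root poset $C_n$: $\Phi^+=\{\pm e_i+e_j:i<j\}\cup\{2e_i\}$, $\alpha\le\beta$ iff $\beta-\alpha$ is a sum of positive roots. For $\beta\in\mathcal B_{2n}$: $\alpha_{i,j}=e_{n+1-i}-e_{n+1-j}$ ($j\le n$), $e_{n+1-i}+e_{j-n}$ ($j>n$) for valleys $(i,j)$; $A_\beta$ the set of these; $I_\beta=\{x\in\Phi^+:$ no $y\in A_\beta$ with $y\le x\}$; $\operatorname{area}'(\beta,w)=\#\{x\in I_\beta: w\cdot x\in\Phi^+\}$. $\operatorname{dinv}'_C(\pi,u)$ is the sum of: $\#\{(i,j):i<j,\mu_{n-i+1}=\mu_{n-j+1},u(i)<u(j)\}$, $\#\{(i,j):i<j,\mu_{n-i+1}=\mu_{n-j+1}+1,u(i)>u(j)\}$, $\#\{(i,j):i<j,\mu_{n-i+1}=-\mu_{n-j+1},u(i)<-u(j)\}$, $\#\{(i,j):i<j,\mu_{n-i+1}=-\mu_{n-j+1}+1,u(i)>-u(j)\}$, and $\#\{i:\mu_{n-i+1}=0,u(i)<0\}$, with $i,j\in[n]$. -}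

module Defs where

open import Data.Nat as ℕ using (ℕ; zero; suc; _∸_; _≤ᵇ_; _≡ᵇ_)
open import Data.Integer as ℤ using (ℤ; +_; -[1+_]; -_; _<_; ∣_∣)
open import Data.Integer.Properties as ℤP using ()
open import Data.Bool using (Bool; true; false; if_then_else_; _∧_)
open import Data.List using (List; []; _∷_; _++_; map; concatMap; reverse; upTo; length; filter)
open import Data.List.Membership.Propositional using (_∈_)
open import Data.List.Relation.Unary.All using (All)
open import Data.Vec as Vec using (Vec; tabulate; zipWith; replicate; lookup)
open import Data.Fin using (Fin; toℕ)
open import Data.Product using (_×_; _,_; Σ; ∃-syntax)
open import Relation.Binary.PropositionalEquality using (_≡_; _≢_)
open import Relation.Nullary using (¬_; does)

data Step : Set where
  N E : Step

isN : Step → Bool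
isN N = true
isN E = false

isE : Step → Bool
isE N = false
isE E = true

countB : {A : Set} → (A → Bool) → List A → ℕ
countB p [] = 0
countB p (x ∷ xs) = if p x then suc (countB p xs) else countB p xs

InL : ℕ → List Step → Set
InL n π = countB isN π ≡ n × countB isE π ≡ n

oneTo : ℕ → List ℕ
oneTo n = map suc (upTo n)

-- 1-based lookup in a list of naturals (default 0, only used in range)
nthℕ : List ℕ → ℕ → ℕ
nthℕ [] _ = 0
nthℕ (x ∷ xs) zero = 0
nthℕ (x ∷ xs) (suc zero) = x
nthℕ (x ∷ xs) (suc (suc k)) = nthℕ xs (suc k)

-- 1-based lookup in a vector of integers (default 0, only used in range)
_⟦_⟧ : {n : ℕ} → Vec ℤ n → ℕ → ℤ
Vec.[] ⟦ _ ⟧ = + 0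
(x Vec.∷ xs) ⟦ zero ⟧ = + 0
(x Vec.∷ xs) ⟦ suc zero ⟧ = x
(x Vec.∷ xs) ⟦ suc (suc k) ⟧ = xs ⟦ suc k ⟧

lamAux : ℕ → List Step → List ℕ
lamAux e [] = []
lamAux e (N ∷ r) = e ∷ lamAux e r
lamAux e (E ∷ r) = lamAux (suc e) r

lam : List Step → List ℕ
lam = lamAux 0

mu : ℕ → List Step → ℕ → ℤ
mu n π i = (+ (suc n ∸ i)) ℤ.- (+ nthℕ (lam π) (suc n ∸ i))

muList : ℕ → List Step → List ℤ
muList n π = map (mu n π) (oneTo n)

eqℤ : ℤ → ℤ → Bool
eqℤ a b = does (a ℤ.≟ b)

letter : ℤ → ℤ → ℤ → List Step
letter p q x = if eqℤ x p then N ∷ [] else (if eqℤ x q then E ∷ [] else [])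

S⃗⁺ : ℕ → List ℤ → List Step
S⃗⁺ j a = concatMap (letter (+ j) (+ suc j)) a

S⃖⁺ : ℕ → List ℤ → List Step
S⃖⁺ j a = concatMap (letter (+ j) (+ suc j)) (reverse a)

S⃗⁻ : ℕ → List ℤ → List Step
S⃗⁻ j a = concatMap (letter (- (+ j)) (- (+ suc j))) a

S⃖⁻ : ℕ → List ℤ → List Step
S⃖⁻ j a = concatMap (letter (- (+ j)) (- (+ suc j))) (reverse a)

zetaAux : List ℤ → ℕ → List Step
zetaAux a zero = S⃖⁻ 0 a ++ S⃗⁺ 0 a
zetaAux a (suc j) = (S⃖⁻ (suc j) a ++ S⃗⁺ (suc j) a) ++ zetaAux a j

zetaC : ℕ → List Step → List Step
zetaC n π = zetaAux (muList n π) n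

risesAux : ℕ → List Step → List ℕ
risesAux k [] = []
risesAux k (E ∷ r) = risesAux k r
risesAux k (N ∷ []) = []
risesAux k (N ∷ N ∷ r) = suc k ∷ risesAux (suc k) (N ∷ r)
risesAux k (N ∷ E ∷ r) = risesAux (suc k) (E ∷ r)

rises : List Step → List ℕ
rises = risesAux 0

-- u ∈ 𝔖_n^C, given by its window (u(1), …, u(n)); u(-i) = -u(i).
-- This is a bijection of {±1,…,±n} iff each u(i) ∈ {±1,…,±n} and
-- i ↦ |u(i)| is injective on [n].
IsSignedPerm : (n : ℕ) → Vec ℤ n → Set
IsSignedPerm n u =
  (∀ (i : Fin n) → lookup u i ≢ + 0 × ∣ lookup u i ∣ ℕ.≤ n) ×
  (∀ (i j : Fin n) → ∣ lookup u i ∣ ≡ ∣ lookup u j ∣ → i ≡ j)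

InVert : (n : ℕ) → List Step → Vec ℤ n → Set
InVert n π u =
  InL n π × IsSignedPerm n u ×
  (∀ i → i ∈ rises π → u ⟦ i ⟧ < u ⟦ suc i ⟧) ×
  (∀ rest → π ≡ N ∷ rest → + 0 < u ⟦ 1 ⟧)

-- d_C(π,u), as a window (list of n integers)

dC : (n : ℕ) → List Step → Vec ℤ n → List ℤ
dC n π u = concatMap block (upTo (suc n))
  where
  block : ℕ → List ℤ
  block i =
    map (λ j → - (u ⟦ j ⟧))
        (filter (λ j → mu n π (suc n ∸ j) ℤ.≟ - (+ i)) (reverse (oneTo n)))
    ++ map (λ j → u ⟦ j ⟧)
        (filter (λ j → mu n π (suc n ∸ j) ℤ.≟ + suc i) (oneTo n))

vzero : {n : ℕ} → Vec ℤ n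
vzero = replicate _ (+ 0)

_⊕_ : {n : ℕ} → Vec ℤ n → Vec ℤ n → Vec ℤ n
_⊕_ = zipWith ℤ._+_

_⊖_ : {n : ℕ} → Vec ℤ n → Vec ℤ n → Vec ℤ n
_⊖_ = zipWith ℤ._-_

_•_ : {n : ℕ} → ℤ → Vec ℤ n → Vec ℤ n
c • v = Vec.map (c ℤ.*_) v

vsum : {n : ℕ} → List (Vec ℤ n) → Vec ℤ n
vsum [] = vzero
vsum (v ∷ vs) = v ⊕ vsum vs

e : (n : ℕ) → ℕ → Vec ℤ n
e n k = tabulate (λ m → if suc (toℕ m) ≡ᵇ k then + 1 else + 0)

eS : (n : ℕ) → ℤ → Vec ℤ n
eS n (+ k) = e n k
eS n (-[1+ k ]) = (- + 1) • e n (suc k)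

pairs : ℕ → List (ℕ × ℕ)
pairs n = concatMap (λ i → map (λ j → (i , j)) (filter (λ j → i ℕ.<? j) (oneTo n))) (oneTo n)

posRoots : (n : ℕ) → List (Vec ℤ n)
posRoots n =
  concatMap (λ { (i , j) → (e n j ⊖ e n i) ∷ (e n i ⊕ e n j) ∷ [] }) (pairs n)
  ++ map (λ i → (+ 2) • e n i) (oneTo n)

_≤Φ_ : {n : ℕ} → Vec ℤ n → Vec ℤ n → Set
_≤Φ_ {n} α β = ∃[ rs ] (All (_∈ posRoots n) rs × (β ⊖ α) ≡ vsum rs)

-- u · x for a window w = (w(1),…,w(n)), u·e_i = e_{u(i)}, extended linearly
act : (n : ℕ) → List ℤ → Vec ℤ n → Vec ℤ n
act n w x = vsum (map (λ i → (x ⟦ i ⟧) • eS n (wi i)) (oneTo n))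
  where
  wi : ℕ → ℤ
  wi i = nthℤ w i
    where
    nthℤ : List ℤ → ℕ → ℤ
    nthℤ [] _ = + 0
    nthℤ (y ∷ ys) zero = + 0
    nthℤ (y ∷ ys) (suc zero) = y
    nthℤ (y ∷ ys) (suc (suc k)) = nthℤ ys (suc k)

-- valleysAux ne nn β : valleys, where ne (nn) = #E's (#N's) read so far.
-- (i,j): the i-th E is immediately followed by the j-th N; and (i,j+1)
-- if the path (with i E's and j N's) ends with an E.
valleysAux : ℕ → ℕ → List Step → List (ℕ × ℕ)
valleysAux ne nn [] = []
valleysAux ne nn (N ∷ r) = valleysAux ne (suc nn) r
valleysAux ne nn (E ∷ []) = (suc ne , suc nn) ∷ []
valleysAux ne nn (E ∷ N ∷ r) = (suc ne , suc nn) ∷ valleysAux (suc ne) nn (N ∷ r)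
valleysAux ne nn (E ∷ E ∷ r) = valleysAux (suc ne) nn (E ∷ r)

valleys : List Step → List (ℕ × ℕ)
valleys = valleysAux 0 0

alpha : (n : ℕ) → ℕ × ℕ → Vec ℤ n
alpha n (i , j) =
  if j ℕ.≤ᵇ n then e n (suc n ∸ i) ⊖ e n (suc n ∸ j)
              else e n (suc n ∸ i) ⊕ e n (j ∸ n)

InI : (n : ℕ) → List Step → Vec ℤ n → Set
InI n β x = x ∈ posRoots n × ¬ (∃[ v ] (v ∈ valleys β × alpha n v ≤Φ x))

data CountP {A : Set} (P : A → Set) : List A → ℕ → Set where
  c[]  : CountP P [] 0
  cyes : ∀ {x xs k} → P x → CountP P xs k → CountP P (x ∷ xs) (suc k)
  cno  : ∀ {x xs k} → ¬ P x → CountP P xs k → CountP P (x ∷ xs) k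

-- area'(β,w) = k, i.e. #{x ∈ I_β : w·x ∈ Φ⁺} = k  (posRoots n lists Φ⁺ without repetition)
AreaIs : (n : ℕ) → List Step → List ℤ → ℕ → Set
AreaIs n β w k = CountP (λ x → InI n β x × act n w x ∈ posRoots n) (posRoots n) k

dinv'C : (n : ℕ) → List Step → Vec ℤ n → ℕ
dinv'C n π u =
    countB (λ { (i , j) → does (m i ℤ.≟ m j) ∧ does (u ⟦ i ⟧ ℤ.<? u ⟦ j ⟧) }) (pairs n)
  ℕ.+ countB (λ { (i , j) → does (m i ℤ.≟ m j ℤ.+ + 1) ∧ does (u ⟦ j ⟧ ℤ.<? u ⟦ i ⟧) }) (pairs n)
  ℕ.+ countB (λ { (i , j) → does (m i ℤ.≟ - m j) ∧ does (u ⟦ i ⟧ ℤ.<? - u ⟦ j ⟧) }) (pairs n)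
  ℕ.+ countB (λ { (i , j) → does (m i ℤ.≟ - m j ℤ.+ + 1) ∧ does (- u ⟦ j ⟧ ℤ.<? u ⟦ i ⟧) }) (pairs n)
  ℕ.+ countB (λ i → does (m i ℤ.≟ + 0) ∧ does (u ⟦ i ⟧ ℤ.<? + 0)) (oneTo n)
  where
  m : ℕ → ℤ
  m i = mu n π (suc n ∸ i)

{-# OPTIONS --safe #-}

-- Put c j = μ (n + 1 − j). Every letter of the zeta word comes from an index j: an N and, if c j ≢ 0, an E
-- two blocks further on; an index with c j ≡ 0 contributes a second N in the last block. The i-th E and the i-th N
-- belong to the window position n + 1 − i, and the (n + a)-th N to position a. Since α ≤ β for the roots of two cells
-- (i , j) exactly when the cells are nested, the root of (i , j) lies in I iff the j-th N precedes the i-th E, and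
-- w sends e b ± e a to a positive root iff ∓ w a < w b. So for window positions a < b with indices p , q the two roots
-- e b ± e a contribute only if the blocks of p and q are at most two apart, and in each of these cases they contribute
-- what {p , q} contributes to dinv′. The roots 2 e a account for the last summand of dinv′ in the same way.
-- Summing over all positions gives the theorem, since the window is a permutation of [n].
module Submission where

open import Defs
open import Data.Bool using (Bool; true; false; if_then_else_; _∧_)
open import Data.Empty using (⊥; ⊥-elim)
open import Data.Fin as Fin using (Fin)
open import Data.Integer as ℤ using (ℤ; +_; -[1+_]; +[1+_]; -_; ∣_∣; 0ℤ; 1ℤ)
import Data.Integer.Properties as ℤP
open import Data.Integer.Tactic.RingSolver using (solve-∀)
open import Data.List using (List; []; _∷_; _++_; map; concatMap; filter; reverse; upTo; downFrom; length)
open import Data.List.Membership.Propositional using (_∈_; find; lose)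
open import Data.List.Membership.Propositional.Properties using (∈-++⁺ʳ; ∈-++⁺ˡ; ∈-++⁻; ∈-concatMap⁺; ∈-concatMap⁻; ∈-filter⁺; ∈-filter⁻; ∈-map⁺; ∈-map⁻; ∈-upTo⁺; ∈-upTo⁻)
open import Data.List.Membership.Propositional.Properties.WithK using (unique∧set⇒bag)
open import Data.List.Properties using (++-assoc; ++-identityʳ; concatMap-++; concatMap-cong; filter-++; filter-all; filter-none; filter-reject; length-++; length-map; length-reverse; length-upTo; map-++; map-concatMap; map-cong; map-cong-local; map-id; map-upTo; map-∘; reverse-++; reverse-involutive; reverse-map; reverse-upTo; unfold-reverse; upTo-∷ʳ)
open import Data.List.Relation.Binary.BagAndSetEquality using (∼bag⇒↭)
open import Data.List.Relation.Binary.Permutation.Propositional using (_↭_; ↭-trans)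
import Data.List.Relation.Binary.Permutation.Propositional.Properties as ↭P
open import Data.List.Relation.Unary.All as All using (All; []; _∷_)
import Data.List.Relation.Unary.All.Properties as AllP
open import Data.List.Relation.Unary.AllPairs as AllPairs using (AllPairs; []; _∷_)
import Data.List.Relation.Unary.AllPairs.Properties as AllPairsP
open import Data.List.Relation.Unary.Any using (here; there)
import Data.List.Relation.Unary.Any.Properties as AnyP
open import Data.Nat as ℕ using (ℕ; zero; suc; _≤_; _∸_; z≤n; s≤s)
open import Data.Nat.ListAction using (sum)
open import Data.Nat.ListAction.Properties using (sum-↭; sum-++)
import Data.Nat.Properties as ℕP
open import Data.Nat.Tactic.RingSolver renaming (solve-∀ to solve-∀ℕ)
open import Data.Product using (_×_; _,_; proj₁; proj₂; ∃-syntax)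
open import Data.Sum using (_⊎_; inj₁; inj₂)
open import Data.Vec as Vec using (Vec; lookup)
open import Data.Vec.Properties using (lookup-zipWith; lookup-map; lookup-replicate; tabulate∘lookup; tabulate-cong)
open import Function using (_∘_)
open import Function.Bundles using (mk⇔)
open import Relation.Binary.Definitions using (tri<; tri≈; tri>)
open import Relation.Binary.PropositionalEquality
open import Relation.Nullary using (Dec; ¬_; yes; no; does; Reflects; ofʸ; ofⁿ)
open import Relation.Nullary.Decidable using (dec-true; dec-false; does-⇔)
open import Relation.Nullary.Reflects using (_×-reflects_)

-- `AreaIs` asks for a proof or a refutation of membership in I at every root, and that membership
-- quantifies over all lists of positive roots. Refutations of `_≤Φ_` come from coweights, which are
-- monotone for it, so the root order is only ever used as nesting of cells. On the side of the
-- word, each letter carries the key (index, block), the keys increase strictly for `_≺_` along the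
-- word, and the order of two letters is the order of their keys. The index behind a position can be
-- read off because the labels of the E's are those of the first `n` N's with the indices of entry 0
-- cut off at the end; the same indices, reversed, label the remaining N's and open the window. The
-- blocks of the first N's enumerate the entries as 0, 1, -1, 2, -2, ..., so at block distance 0, 1
-- or 2 one entry determines the other, and the comparison with dinv′ is a finite list of cases. Two
-- equations of dinv′ hold at once only if an entry is 0, and exactly then the root e b + e a lies
-- in I.

InRange : ℕ → ℕ → Set
InRange n a = 1 ≤ a × a ≤ n

∈-oneTo⁺ : ∀ {n a} → InRange n a → a ∈ oneTo n
∈-oneTo⁺ {a = suc a} (_ , a<n) = ∈-map⁺ suc (∈-upTo⁺ a<n)

∈-oneTo⁻ : ∀ {n a} → a ∈ oneTo n → InRange n a
∈-oneTo⁻ a∈ with _ , i∈ , refl ← ∈-map⁻ suc a∈ = s≤s z≤n , ∈-upTo⁻ i∈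

oneTo-suc : ∀ n → oneTo (suc n) ≡ 1 ∷ map suc (oneTo n)
oneTo-suc n = cong (λ xs → 1 ∷ map suc xs) (sym (map-upTo suc n))

∈-pairs⁺ : ∀ {n a b} → 1 ≤ a → a ℕ.< b → b ≤ n → (a , b) ∈ pairs n
∈-pairs⁺ {n} {a} 1≤a a<b b≤n = ∈-concatMap⁺ _
  (lose (∈-oneTo⁺ (1≤a , ℕP.≤-trans (ℕP.<⇒≤ a<b) b≤n))
    (∈-map⁺ (a ,_) (∈-filter⁺ (a ℕ.<?_) (∈-oneTo⁺ (ℕP.≤-trans (s≤s z≤n) a<b , b≤n)) a<b)))

∈-pairs⁻ : ∀ {n a b} → (a , b) ∈ pairs n → 1 ≤ a × a ℕ.< b × b ≤ n
∈-pairs⁻ {n} ab∈ with i , i∈ , ab∈i ← find (∈-concatMap⁻ _ {xs = oneTo n} ab∈)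
  with _ , j∈ , refl ← ∈-map⁻ (i ,_) ab∈i
  with j∈′ , i<j ← ∈-filter⁻ (i ℕ.<?_) {xs = oneTo n} j∈
  = proj₁ (∈-oneTo⁻ i∈) , i<j , proj₂ (∈-oneTo⁻ j∈′)

-- Linear functionals, given by their values on the basis

dot : ∀ {n} → (ℕ → ℤ) → Vec ℤ n → ℤ
dot g Vec.[] = 0ℤ
dot g (x Vec.∷ xs) = x ℤ.* g 1 ℤ.+ dot (g ∘ suc) xs

dot-vzero : ∀ n (g : ℕ → ℤ) → dot g (vzero {n}) ≡ 0ℤ
dot-vzero zero g = refl
dot-vzero (suc n) g = trans (ℤP.+-identityˡ _) (dot-vzero n (g ∘ suc))

dot-⊕ : ∀ {n} g (x y : Vec ℤ n) → dot g (x ⊕ y) ≡ dot g x ℤ.+ dot g y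
dot-⊕ g Vec.[] Vec.[] = refl
dot-⊕ g (x Vec.∷ xs) (y Vec.∷ ys) =
  trans (cong (λ s → (x ℤ.+ y) ℤ.* g 1 ℤ.+ s) (dot-⊕ (g ∘ suc) xs ys)) (distrib x y (g 1) _ _)
  where
  distrib : ∀ x y z a b → (x ℤ.+ y) ℤ.* z ℤ.+ (a ℤ.+ b) ≡ (x ℤ.* z ℤ.+ a) ℤ.+ (y ℤ.* z ℤ.+ b)
  distrib = solve-∀

dot-⊖ : ∀ {n} g (x y : Vec ℤ n) → dot g (x ⊖ y) ≡ dot g x ℤ.- dot g y
dot-⊖ g Vec.[] Vec.[] = refl
dot-⊖ g (x Vec.∷ xs) (y Vec.∷ ys) =
  trans (cong (λ s → (x ℤ.- y) ℤ.* g 1 ℤ.+ s) (dot-⊖ (g ∘ suc) xs ys)) (distrib x y (g 1) _ _)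
  where
  distrib : ∀ x y z a b → (x ℤ.- y) ℤ.* z ℤ.+ (a ℤ.- b) ≡ (x ℤ.* z ℤ.+ a) ℤ.- (y ℤ.* z ℤ.+ b)
  distrib = solve-∀

dot-• : ∀ {n} g c (x : Vec ℤ n) → dot g (c • x) ≡ c ℤ.* dot g x
dot-• g c Vec.[] = sym (ℤP.*-zeroʳ c)
dot-• g c (x Vec.∷ xs) =
  trans (cong (λ s → (c ℤ.* x) ℤ.* g 1 ℤ.+ s) (dot-• (g ∘ suc) c xs)) (distrib c x (g 1) _)
  where
  distrib : ∀ c x z a → (c ℤ.* x) ℤ.* z ℤ.+ c ℤ.* a ≡ c ℤ.* (x ℤ.* z ℤ.+ a)
  distrib = solve-∀

-- The tail of `e (suc n) 1` is `e n 0`, an out-of-range index at which no coordinate is 1.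
dot-e₀ : ∀ n g → dot g (e n 0) ≡ 0ℤ
dot-e₀ zero g = refl
dot-e₀ (suc n) g = trans (ℤP.+-identityˡ _) (dot-e₀ n (g ∘ suc))

dot-e : ∀ {n} g {a} → InRange n a → dot g (e n a) ≡ g a
dot-e {suc n} g {suc zero} _ =
  trans (cong (λ s → 1ℤ ℤ.* g 1 ℤ.+ s) (dot-e₀ n (g ∘ suc))) (trans (ℤP.+-identityʳ _) (ℤP.*-identityˡ _))
dot-e {suc n} g {suc (suc a)} (_ , s≤s a<n) =
  trans (ℤP.+-identityˡ _) (dot-e {n} (g ∘ suc) {suc a} (s≤s z≤n , a<n))

dot-vsum≥0 : ∀ {n} g (rs : List (Vec ℤ n)) → All (λ r → 0ℤ ℤ.≤ dot g r) rs → 0ℤ ℤ.≤ dot g (vsum rs)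
dot-vsum≥0 {n} g [] [] = ℤP.≤-reflexive (sym (dot-vzero n g))
dot-vsum≥0 g (r ∷ rs) (p ∷ ps) =
  ℤP.≤-trans (ℤP.+-mono-≤ p (dot-vsum≥0 g rs ps)) (ℤP.≤-reflexive (sym (dot-⊕ g r (vsum rs))))

vec-ext : ∀ {n} {x y : Vec ℤ n} → (∀ m → lookup x m ≡ lookup y m) → x ≡ y
vec-ext {x = x} {y} eq = trans (sym (tabulate∘lookup x)) (trans (tabulate-cong eq) (tabulate∘lookup y))

lookup-⊕ : ∀ {n} (x y : Vec ℤ n) m → lookup (x ⊕ y) m ≡ lookup x m ℤ.+ lookup y m
lookup-⊕ x y m = lookup-zipWith ℤ._+_ m x y

lookup-⊖ : ∀ {n} (x y : Vec ℤ n) m → lookup (x ⊖ y) m ≡ lookup x m ℤ.- lookup y m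
lookup-⊖ x y m = lookup-zipWith ℤ._-_ m x y

lookup-• : ∀ {n} c (x : Vec ℤ n) m → lookup (c • x) m ≡ c ℤ.* lookup x m
lookup-• c x m = lookup-map m (c ℤ.*_) x

-- Positive roots

diff∈posRoots : ∀ {n a b} → 1 ≤ a → a ℕ.< b → b ≤ n → e n b ⊖ e n a ∈ posRoots n
diff∈posRoots 1≤a a<b b≤n =
  ∈-++⁺ˡ (∈-concatMap⁺ _ (lose (∈-pairs⁺ 1≤a a<b b≤n) (here refl)))

sum∈posRoots : ∀ {n a b} → 1 ≤ a → a ℕ.< b → b ≤ n → e n a ⊕ e n b ∈ posRoots n
sum∈posRoots 1≤a a<b b≤n =
  ∈-++⁺ˡ (∈-concatMap⁺ _ (lose (∈-pairs⁺ 1≤a a<b b≤n) (there (here refl))))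

double∈posRoots : ∀ {n a} → InRange n a → (+ 2) • e n a ∈ posRoots n
double∈posRoots {n} a∈ = ∈-++⁺ʳ _ (∈-map⁺ (λ i → (+ 2) • e n i) (∈-oneTo⁺ a∈))

posRoots-elim : ∀ {n} (P : Vec ℤ n → Set) →
  (∀ {a b} → 1 ≤ a → a ℕ.< b → b ≤ n → P (e n b ⊖ e n a)) →
  (∀ {a b} → 1 ≤ a → a ℕ.< b → b ≤ n → P (e n a ⊕ e n b)) →
  (∀ {a} → InRange n a → P ((+ 2) • e n a)) →
  ∀ {r} → r ∈ posRoots n → P r
posRoots-elim {n} P pd ps p2 r∈ with ∈-++⁻ (concatMap _ (pairs n)) r∈
... | inj₂ r∈2 with _ , i∈ , refl ← ∈-map⁻ (λ i → (+ 2) • e n i) r∈2 = p2 (∈-oneTo⁻ i∈)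
... | inj₁ r∈p with (a , b) , ab∈ , r∈ab ← find (∈-concatMap⁻ _ {xs = pairs n} r∈p)
  with 1≤a , a<b , b≤n ← ∈-pairs⁻ {n} ab∈ with r∈ab
... | here refl = pd 1≤a a<b b≤n
... | there (here refl) = ps 1≤a a<b b≤n

dot-diff : ∀ {n} g {a b} → InRange n a → InRange n b → dot g (e n b ⊖ e n a) ≡ g b ℤ.- g a
dot-diff {n} g {a} {b} a∈ b∈ = trans (dot-⊖ g (e n b) (e n a)) (cong₂ ℤ._-_ (dot-e g b∈) (dot-e g a∈))

dot-sum : ∀ {n} g {a b} → InRange n a → InRange n b → dot g (e n a ⊕ e n b) ≡ g a ℤ.+ g b
dot-sum {n} g {a} {b} a∈ b∈ = trans (dot-⊕ g (e n a) (e n b)) (cong₂ ℤ._+_ (dot-e g a∈) (dot-e g b∈))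

dot-double : ∀ {n} g {a} → InRange n a → dot g ((+ 2) • e n a) ≡ (+ 2) ℤ.* g a
dot-double {n} g {a} a∈ = trans (dot-• g (+ 2) (e n a)) (cong ((+ 2) ℤ.*_) (dot-e g a∈))

0<j-i : ∀ {i j} → i ℤ.< j → 0ℤ ℤ.< j ℤ.- i
0<j-i {i} {j} i<j = subst (ℤ._< j ℤ.- i) (ℤP.+-inverseʳ i) (ℤP.+-monoˡ-< (- i) i<j)

-- The three kinds of roots get the values b - a, a + b and 2 a. Strict positivity later shows that
-- neither 0 nor the negative of a positive root is a positive root.
height>0 : ∀ {n} {r : Vec ℤ n} → r ∈ posRoots n → 0ℤ ℤ.< dot +_ r
height>0 {n} = posRoots-elim (λ r → 0ℤ ℤ.< dot +_ r)
  (λ 1≤a a<b b≤n → let a∈ = 1≤a , ℕP.≤-trans (ℕP.<⇒≤ a<b) b≤n ; b∈ = ℕP.≤-trans 1≤a (ℕP.<⇒≤ a<b) , b≤n in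
    subst (0ℤ ℤ.<_) (sym (dot-diff +_ a∈ b∈)) (0<j-i (ℤ.+<+ a<b)))
  (λ 1≤a a<b b≤n → let a∈ = 1≤a , ℕP.≤-trans (ℕP.<⇒≤ a<b) b≤n ; b∈ = ℕP.≤-trans 1≤a (ℕP.<⇒≤ a<b) , b≤n in
    subst (0ℤ ℤ.<_) (sym (dot-sum +_ a∈ b∈)) (ℤ.+<+ (ℕP.≤-trans 1≤a (ℕP.m≤m+n _ _))))
  (λ { {suc a} a∈ → subst (0ℤ ℤ.<_) (sym (dot-double +_ a∈)) (ℤ.+<+ (s≤s z≤n)) })

-- For 1 ≤ k ≤ n, the fundamental coweights for the simple roots 2 e 1 and e k - e (k - 1), doubled
-- at k = 1 to stay integral. They are nonnegative on positive roots, hence monotone for `_≤Φ_`.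
coweight : ℕ → ℕ → ℤ
coweight k m = if k ℕ.≤ᵇ m then 1ℤ else 0ℤ

≤ᵇ-true : ∀ {m n} → m ≤ n → (m ℕ.≤ᵇ n) ≡ true
≤ᵇ-true {m} {n} = dec-true (m ℕ.≤? n)

≤ᵇ-false : ∀ {m n} → n ℕ.< m → (m ℕ.≤ᵇ n) ≡ false
≤ᵇ-false {m} {n} n<m = dec-false (m ℕ.≤? n) (ℕP.<⇒≱ n<m)

coweight-≤ : ∀ {k m} → k ≤ m → coweight k m ≡ 1ℤ
coweight-≤ k≤m = cong (if_then 1ℤ else 0ℤ) (≤ᵇ-true k≤m)

coweight-< : ∀ {k m} → m ℕ.< k → coweight k m ≡ 0ℤ
coweight-< m<k = cong (if_then 1ℤ else 0ℤ) (≤ᵇ-false m<k)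

coweight≥0 : ∀ k m → 0ℤ ℤ.≤ coweight k m
coweight≥0 k m with k ℕ.≤ᵇ m
... | true = ℤ.+≤+ z≤n
... | false = ℤ.+≤+ z≤n

coweight-mono : ∀ k {a b} → a ≤ b → coweight k a ℤ.≤ coweight k b
coweight-mono k {a} {b} a≤b with k ℕ.≤? a
... | yes k≤a = ℤP.≤-reflexive (trans (coweight-≤ k≤a) (sym (coweight-≤ (ℕP.≤-trans k≤a a≤b))))
... | no k≰a = subst (ℤ._≤ coweight k b) (sym (coweight-< (ℕP.≰⇒> k≰a))) (coweight≥0 k b)

coweight-root≥0 : ∀ {n} k {r : Vec ℤ n} → r ∈ posRoots n → 0ℤ ℤ.≤ dot (coweight k) r
coweight-root≥0 {n} k = posRoots-elim (λ r → 0ℤ ℤ.≤ dot (coweight k) r)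
  (λ 1≤a a<b b≤n → let a∈ = 1≤a , ℕP.≤-trans (ℕP.<⇒≤ a<b) b≤n ; b∈ = ℕP.≤-trans 1≤a (ℕP.<⇒≤ a<b) , b≤n in
    subst (0ℤ ℤ.≤_) (sym (dot-diff _ a∈ b∈)) (ℤP.i≤j⇒0≤j-i (coweight-mono k (ℕP.<⇒≤ a<b))))
  (λ 1≤a a<b b≤n → let a∈ = 1≤a , ℕP.≤-trans (ℕP.<⇒≤ a<b) b≤n ; b∈ = ℕP.≤-trans 1≤a (ℕP.<⇒≤ a<b) , b≤n in
    subst (0ℤ ℤ.≤_) (sym (dot-sum _ a∈ b∈)) (ℤP.+-mono-≤ (coweight≥0 k _) (coweight≥0 k _)))
  (λ {a} a∈ → subst (0ℤ ℤ.≤_) (sym (dot-double _ a∈)) (ℤP.*-monoˡ-≤-nonNeg (+ 2) (coweight≥0 k a)))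

coweight-≤Φ : ∀ {n} k {α β : Vec ℤ n} → α ≤Φ β → dot (coweight k) α ℤ.≤ dot (coweight k) β
coweight-≤Φ k {α} {β} (rs , rs∈ , eq) = ℤP.0≤i-j⇒j≤i
  (subst (0ℤ ℤ.≤_) (trans (cong (dot (coweight k)) (sym eq)) (dot-⊖ _ β α))
    (dot-vsum≥0 _ rs (All.map (coweight-root≥0 k) rs∈)))

-- The root order on the cells (i , j) indexing the roots alpha n (i , j)

Cell : ℕ → ℕ × ℕ → Set
Cell n (i , j) = 1 ≤ i × i ≤ n × i ℕ.< j × i ℕ.+ j ≤ suc (n ℕ.+ n)

∸-range : ∀ {n a} → InRange n a → InRange n (suc n ∸ a)
∸-range {n} {suc a} (_ , a<n) = ℕP.m<n⇒0<n∸m a<n , ℕP.m∸n≤m n a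

-- Cells correspond to positive roots: `diff` to e b - e a, `summ` to e b + e a, including 2 e a at
-- `a ≡ b`. For `summ` the coordinates add up to 2 n + 1 - (b - a), so the bound in `Cell` says
-- `a ≤ b`.
data CellView (n : ℕ) : ℕ × ℕ → Set where
  diff : ∀ {a b} → 1 ≤ a → a ℕ.< b → b ≤ n → CellView n (suc n ∸ b , suc n ∸ a)
  summ : ∀ {a b} → 1 ≤ a → a ≤ b → b ≤ n → CellView n (suc n ∸ b , n ℕ.+ a)

cellView : ∀ {n i j} → Cell n (i , j) → CellView n (i , j)
cellView {n} {i} {j} (1≤i , i≤n , i<j , i+j≤) with j ℕ.≤? n
... | yes j≤n = subst (CellView n) (cong₂ _,_ (ℕP.m∸[m∸n]≡n (ℕP.m≤n⇒m≤1+n i≤n)) (ℕP.m∸[m∸n]≡n (ℕP.m≤n⇒m≤1+n j≤n)))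
    (diff {a = suc n ∸ j} {b = suc n ∸ i} (ℕP.m<n⇒0<n∸m (s≤s j≤n))
      (ℕP.∸-monoʳ-< i<j (ℕP.m≤n⇒m≤1+n j≤n)) (proj₂ (∸-range (1≤i , i≤n))))
... | no j≰n = subst (CellView n) (cong₂ _,_ (ℕP.m∸[m∸n]≡n (ℕP.m≤n⇒m≤1+n i≤n)) (ℕP.m+[n∸m]≡n (ℕP.<⇒≤ n<j)))
    (summ {a = j ∸ n} {b = suc n ∸ i} (ℕP.m<n⇒0<n∸m n<j) a≤b (proj₂ (∸-range (1≤i , i≤n))))
  where
  n<j = ℕP.≰⇒> j≰n
  a≤b : j ∸ n ≤ suc n ∸ i
  a≤b = ℕP.m+n≤o⇒m≤o∸n (j ∸ n) (ℕP.+-cancelˡ-≤ n _ _ (begin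
    n ℕ.+ (j ∸ n ℕ.+ i)   ≡⟨ ℕP.+-assoc n (j ∸ n) i ⟨
    n ℕ.+ (j ∸ n) ℕ.+ i   ≡⟨ cong (ℕ._+ i) (ℕP.m+[n∸m]≡n (ℕP.<⇒≤ n<j)) ⟩
    j ℕ.+ i               ≡⟨ ℕP.+-comm j i ⟩
    i ℕ.+ j               ≤⟨ i+j≤ ⟩
    suc (n ℕ.+ n)         ≡⟨ ℕP.+-suc n n ⟨
    n ℕ.+ suc n           ∎))
    where open ℕP.≤-Reasoning

alpha-diff : ∀ {n a b} → 1 ≤ a → a ℕ.< b → b ≤ n → alpha n (suc n ∸ b , suc n ∸ a) ≡ e n b ⊖ e n a
alpha-diff {n} {suc a} {b} 1≤a a<b b≤n
  rewrite ≤ᵇ-true {suc n ∸ suc a} {n} (ℕP.m∸n≤m n a)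
        | ℕP.m∸[m∸n]≡n (ℕP.m≤n⇒m≤1+n b≤n)
        | ℕP.m∸[m∸n]≡n (s≤s (ℕP.≤-trans (ℕP.n≤1+n a) (ℕP.≤-trans (ℕP.<⇒≤ a<b) b≤n))) = refl

alpha-summ : ∀ {n a b} → 1 ≤ a → b ≤ n → alpha n (suc n ∸ b , n ℕ.+ a) ≡ e n b ⊕ e n a
alpha-summ {n} {a} {b} 1≤a b≤n
  rewrite ≤ᵇ-false {n ℕ.+ a} {n} (ℕP.m<m+n n 1≤a)
        | ℕP.m∸[m∸n]≡n (ℕP.m≤n⇒m≤1+n b≤n)
        | ℕP.m+n∸m≡n n a = refl

IsRootSum : ∀ {n} → Vec ℤ n → Set
IsRootSum {n} v = ∃[ rs ] (All (_∈ posRoots n) rs × v ≡ vsum rs)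

vsum-++ : ∀ {n} (rs ss : List (Vec ℤ n)) → vsum (rs ++ ss) ≡ vsum rs ⊕ vsum ss
vsum-++ [] ss = vec-ext λ m → sym (trans (lookup-⊕ vzero _ m)
  (trans (cong (ℤ._+ lookup (vsum ss) m) (lookup-replicate m 0ℤ)) (ℤP.+-identityˡ _)))
vsum-++ (r ∷ rs) ss rewrite vsum-++ rs ss = vec-ext λ m → begin
  lookup (r ⊕ (vsum rs ⊕ vsum ss)) m                        ≡⟨ lookup-⊕ r _ m ⟩
  lookup r m ℤ.+ lookup (vsum rs ⊕ vsum ss) m               ≡⟨ cong (λ s → lookup r m ℤ.+ s) (lookup-⊕ (vsum rs) _ m) ⟩
  lookup r m ℤ.+ (lookup (vsum rs) m ℤ.+ lookup (vsum ss) m) ≡⟨ ℤP.+-assoc (lookup r m) _ _ ⟨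
  (lookup r m ℤ.+ lookup (vsum rs) m) ℤ.+ lookup (vsum ss) m ≡⟨ cong (ℤ._+ _) (lookup-⊕ r (vsum rs) m) ⟨
  lookup (r ⊕ vsum rs) m ℤ.+ lookup (vsum ss) m             ≡⟨ lookup-⊕ (r ⊕ vsum rs) _ m ⟨
  lookup ((r ⊕ vsum rs) ⊕ vsum ss) m                        ∎
  where open ≡-Reasoning

isRootSum-⊕ : ∀ {n} {v w : Vec ℤ n} → IsRootSum v → IsRootSum w → IsRootSum (v ⊕ w)
isRootSum-⊕ (rs , rs∈ , refl) (ss , ss∈ , refl) = rs ++ ss , AllP.++⁺ rs∈ ss∈ , sym (vsum-++ rs ss)

isRootSum-root : ∀ {n} {v : Vec ℤ n} → v ∈ posRoots n → IsRootSum v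
isRootSum-root {v = v} v∈ = v ∷ [] , v∈ ∷ [] , vec-ext λ m → sym (trans (lookup-⊕ v vzero m)
  (trans (cong (λ s → lookup v m ℤ.+ s) (lookup-replicate m 0ℤ)) (ℤP.+-identityʳ _)))

x⊖x≡0 : ∀ {n} (x : Vec ℤ n) → x ⊖ x ≡ vzero
x⊖x≡0 x = vec-ext λ m → trans (lookup-⊖ x x m)
  (trans (ℤP.+-inverseʳ (lookup x m)) (sym (lookup-replicate m 0ℤ)))

⊕-comm : ∀ {n} (x y : Vec ℤ n) → x ⊕ y ≡ y ⊕ x
⊕-comm x y = vec-ext λ m → trans (lookup-⊕ x y m)
  (trans (ℤP.+-comm (lookup x m) (lookup y m)) (sym (lookup-⊕ y x m)))

isRootSum-diff : ∀ {n a b} → 1 ≤ a → a ≤ b → b ≤ n → IsRootSum (e n b ⊖ e n a)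
isRootSum-diff {n} {a} {b} 1≤a a≤b b≤n with ℕP.m≤n⇒m<n∨m≡n a≤b
... | inj₁ a<b = isRootSum-root (diff∈posRoots 1≤a a<b b≤n)
... | inj₂ refl = [] , [] , x⊖x≡0 (e n a)

x⊕x≡2•x : ∀ {n} (x : Vec ℤ n) → (+ 2) • x ≡ x ⊕ x
x⊕x≡2•x x = vec-ext λ m → trans (lookup-• (+ 2) x m) (trans (2*x (lookup x m)) (sym (lookup-⊕ x x m)))
  where
  2*x : ∀ x → (+ 2) ℤ.* x ≡ x ℤ.+ x
  2*x = solve-∀

sum∈posRoots′ : ∀ {n a b} → InRange n a → InRange n b → e n a ⊕ e n b ∈ posRoots n
sum∈posRoots′ {n} {a} {b} a∈ b∈ with ℕP.<-cmp a b
... | tri< a<b _ _ = sum∈posRoots (proj₁ a∈) a<b (proj₂ b∈)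
... | tri> _ _ b<a = subst (_∈ posRoots n) (⊕-comm (e n b) (e n a)) (sum∈posRoots (proj₁ b∈) b<a (proj₂ a∈))
... | tri≈ _ refl _ = subst (_∈ posRoots n) (x⊕x≡2•x (e n a)) (double∈posRoots a∈)

infix 4 _≤Cell_

_≤Cell_ : ℕ × ℕ → ℕ × ℕ → Set
(i , j) ≤Cell (i′ , j′) = i′ ≤ i × j ≤ j′

∸-cancel-≤ : ∀ {n a b} → b ≤ n → suc n ∸ a ≤ suc n ∸ b → b ≤ a
∸-cancel-≤ {n} b≤n le = ℕP.≮⇒≥ λ a<b → ℕP.<⇒≱ (ℕP.∸-monoʳ-< a<b (ℕP.m≤n⇒m≤1+n b≤n)) le

isRootSum⇒≤Φ : ∀ {n} {α β γ : Vec ℤ n} → IsRootSum γ →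
  (∀ m → lookup β m ℤ.- lookup α m ≡ lookup γ m) → α ≤Φ β
isRootSum⇒≤Φ {α = α} {β} (rs , rs∈ , γ≡) eq =
  rs , rs∈ , trans (vec-ext (λ m → trans (lookup-⊖ β α m) (eq m))) γ≡

-- The difference of the two roots splits into e d - e b and a rest formed from `a` and `c`; nesting
-- makes each of the two parts zero or a positive root.
alpha-mono : ∀ {n i j i′ j′} → Cell n (i , j) → Cell n (i′ , j′) → (i , j) ≤Cell (i′ , j′) →
  alpha n (i , j) ≤Φ alpha n (i′ , j′)
alpha-mono {n} x y (i′≤i , j≤j′) with cellView x | cellView y
... | diff {a} {b} 1≤a a<b b≤n | diff {c} {d} 1≤c c<d d≤n =
  subst₂ _≤Φ_ (sym (alpha-diff 1≤a a<b b≤n)) (sym (alpha-diff 1≤c c<d d≤n))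
    (isRootSum⇒≤Φ (isRootSum-⊕
        (isRootSum-diff (ℕP.≤-trans (s≤s z≤n) a<b) (∸-cancel-≤ b≤n i′≤i) d≤n)
        (isRootSum-diff 1≤c (∸-cancel-≤ (ℕP.≤-trans (ℕP.<⇒≤ c<d) d≤n) j≤j′) (ℕP.≤-trans (ℕP.<⇒≤ a<b) b≤n)))
      λ m → trans (cong₂ ℤ._-_ (lookup-⊖ (e n d) _ m) (lookup-⊖ (e n b) _ m))
        (trans (regroup (lookup (e n a) m) (lookup (e n b) m) (lookup (e n c) m) (lookup (e n d) m))
          (sym (trans (lookup-⊕ (e n d ⊖ e n b) _ m)
            (cong₂ ℤ._+_ (lookup-⊖ (e n d) _ m) (lookup-⊖ (e n a) _ m))))))
  where
  regroup : ∀ a b c d → (d ℤ.- c) ℤ.- (b ℤ.- a) ≡ (d ℤ.- b) ℤ.+ (a ℤ.- c)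
  regroup = solve-∀
... | diff {a} {b} 1≤a a<b b≤n | summ {c} {d} 1≤c c≤d d≤n =
  subst₂ _≤Φ_ (sym (alpha-diff 1≤a a<b b≤n)) (sym (alpha-summ 1≤c d≤n))
    (isRootSum⇒≤Φ (isRootSum-⊕
        (isRootSum-diff (ℕP.≤-trans (s≤s z≤n) a<b) (∸-cancel-≤ b≤n i′≤i) d≤n)
        (isRootSum-root (sum∈posRoots′ (1≤a , ℕP.≤-trans (ℕP.<⇒≤ a<b) b≤n) (1≤c , ℕP.≤-trans c≤d d≤n))))
      λ m → trans (cong₂ ℤ._-_ (lookup-⊕ (e n d) _ m) (lookup-⊖ (e n b) _ m))
        (trans (regroup (lookup (e n a) m) (lookup (e n b) m) (lookup (e n c) m) (lookup (e n d) m))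
          (sym (trans (lookup-⊕ (e n d ⊖ e n b) _ m)
            (cong₂ ℤ._+_ (lookup-⊖ (e n d) _ m) (lookup-⊕ (e n a) _ m))))))
  where
  regroup : ∀ a b c d → (d ℤ.+ c) ℤ.- (b ℤ.- a) ≡ (d ℤ.- b) ℤ.+ (a ℤ.+ c)
  regroup = solve-∀
-- Not nested: a sum has second coordinate above `n`, a difference at most `n`.
... | summ {a} {b} 1≤a a≤b b≤n | diff {suc c} {d} 1≤c c<d d≤n =
  ⊥-elim (ℕP.<⇒≱ (ℕP.m<m+n n 1≤a) (ℕP.≤-trans j≤j′ (ℕP.m∸n≤m n c)))
... | summ {a} {b} 1≤a a≤b b≤n | summ {c} {d} 1≤c c≤d d≤n =
  subst₂ _≤Φ_ (sym (alpha-summ 1≤a b≤n)) (sym (alpha-summ 1≤c d≤n))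
    (isRootSum⇒≤Φ (isRootSum-⊕
        (isRootSum-diff (ℕP.≤-trans 1≤a a≤b) (∸-cancel-≤ b≤n i′≤i) d≤n)
        (isRootSum-diff 1≤a (ℕP.+-cancelˡ-≤ n _ _ j≤j′) (ℕP.≤-trans c≤d d≤n)))
      λ m → trans (cong₂ ℤ._-_ (lookup-⊕ (e n d) _ m) (lookup-⊕ (e n b) _ m))
        (trans (regroup (lookup (e n a) m) (lookup (e n b) m) (lookup (e n c) m) (lookup (e n d) m))
          (sym (trans (lookup-⊕ (e n d ⊖ e n b) _ m)
            (cong₂ ℤ._+_ (lookup-⊖ (e n d) _ m) (lookup-⊖ (e n c) _ m))))))
  where
  regroup : ∀ a b c d → (d ℤ.+ c) ℤ.- (b ℤ.+ a) ≡ (d ℤ.- b) ℤ.+ (c ℤ.- a)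
  regroup = solve-∀


dot-mono-diff-diff : ∀ {n} k {a b c d} → InRange n a → InRange n b → InRange n c → InRange n d →
  (e n b ⊖ e n a) ≤Φ (e n d ⊖ e n c) →
  coweight k b ℤ.- coweight k a ℤ.≤ coweight k d ℤ.- coweight k c
dot-mono-diff-diff k a∈ b∈ c∈ d∈ h =
  subst₂ ℤ._≤_ (dot-diff (coweight k) a∈ b∈) (dot-diff (coweight k) c∈ d∈) (coweight-≤Φ k h)

dot-mono-diff-sum : ∀ {n} k {a b c d} → InRange n a → InRange n b → InRange n c → InRange n d →
  (e n b ⊖ e n a) ≤Φ (e n d ⊕ e n c) →
  coweight k b ℤ.- coweight k a ℤ.≤ coweight k d ℤ.+ coweight k c
dot-mono-diff-sum k a∈ b∈ c∈ d∈ h =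
  subst₂ ℤ._≤_ (dot-diff (coweight k) a∈ b∈) (dot-sum (coweight k) d∈ c∈) (coweight-≤Φ k h)

dot-mono-sum-diff : ∀ {n} k {a b c d} → InRange n a → InRange n b → InRange n c → InRange n d →
  (e n b ⊕ e n a) ≤Φ (e n d ⊖ e n c) →
  coweight k b ℤ.+ coweight k a ℤ.≤ coweight k d ℤ.- coweight k c
dot-mono-sum-diff k a∈ b∈ c∈ d∈ h =
  subst₂ ℤ._≤_ (dot-sum (coweight k) b∈ a∈) (dot-diff (coweight k) c∈ d∈) (coweight-≤Φ k h)

dot-mono-sum-sum : ∀ {n} k {a b c d} → InRange n a → InRange n b → InRange n c → InRange n d →
  (e n b ⊕ e n a) ≤Φ (e n d ⊕ e n c) →
  coweight k b ℤ.+ coweight k a ℤ.≤ coweight k d ℤ.+ coweight k c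
dot-mono-sum-sum k a∈ b∈ c∈ d∈ h =
  subst₂ ℤ._≤_ (dot-sum (coweight k) b∈ a∈) (dot-sum (coweight k) d∈ c∈) (coweight-≤Φ k h)

<-contradiction : ∀ {i j k l} → i ℤ.≤ j → k ℤ.≤ i → j ℤ.≤ l → l ℤ.< k → ⊥
<-contradiction i≤j k≤i j≤l l<k = ℤP.<⇒≱ l<k (ℤP.≤-trans k≤i (ℤP.≤-trans i≤j j≤l))

≥-reflexive : ∀ {i j} → i ≡ j → j ℤ.≤ i
≥-reflexive eq = ℤP.≤-reflexive (sym eq)

0<1 : 0ℤ ℤ.< 1ℤ
0<1 = ℤ.+<+ (s≤s z≤n)

coweight≤1 : ∀ k m → coweight k m ℤ.≤ 1ℤ
coweight≤1 k m with k ℕ.≤ᵇ m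
... | true = ℤ.+≤+ (s≤s z≤n)
... | false = ℤ.+≤+ z≤n

range-< : ∀ {n a b} → 1 ≤ a → a ℕ.< b → b ≤ n → InRange n a × InRange n b
range-< 1≤a a<b b≤n = (1≤a , ℕP.≤-trans (ℕP.<⇒≤ a<b) b≤n) , (ℕP.≤-trans 1≤a (ℕP.<⇒≤ a<b) , b≤n)

range-≤ : ∀ {n a b} → 1 ≤ a → a ≤ b → b ≤ n → InRange n a × InRange n b
range-≤ 1≤a a≤b b≤n = (1≤a , ℕP.≤-trans a≤b b≤n) , (ℕP.≤-trans 1≤a a≤b , b≤n)

-- One coweight refutes each failure of nesting. If `d < b`, coweight `b` vanishes on the larger
-- root only. If the second coordinates are out of order, coweight `suc a` separates two differences
-- (1 against 0) and coweight `a` two sums (2 against at most 1). Coweight 1 is 2 on every sum and 0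
-- on every difference, so no sum lies below a difference.
alpha-cancel : ∀ {n i j i′ j′} → Cell n (i , j) → Cell n (i′ , j′) →
  alpha n (i , j) ≤Φ alpha n (i′ , j′) → (i , j) ≤Cell (i′ , j′)
alpha-cancel {n} x y α≤β with cellView x | cellView y
... | diff {a} {b} 1≤a a<b b≤n | diff {c} {d} 1≤c c<d d≤n =
  ℕP.∸-monoʳ-≤ (suc n) (ℕP.≮⇒≥ b≤d) , ℕP.∸-monoʳ-≤ (suc n) (ℕP.≮⇒≥ c≤a)
  where
  ab = range-< 1≤a a<b b≤n
  cd = range-< 1≤c c<d d≤n
  value : ∀ k → _
  value k = dot-mono-diff-diff k (proj₁ ab) (proj₂ ab) (proj₁ cd) (proj₂ cd)
    (subst₂ _≤Φ_ (alpha-diff 1≤a a<b b≤n) (alpha-diff 1≤c c<d d≤n) α≤β)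
  b≤d : ¬ d ℕ.< b
  b≤d d<b = <-contradiction (value b)
    (≥-reflexive (cong₂ ℤ._-_ (coweight-≤ (ℕP.≤-refl {b})) (coweight-< a<b)))
    (ℤP.≤-reflexive (cong₂ ℤ._-_ (coweight-< d<b) (coweight-< (ℕP.<-trans c<d d<b)))) 0<1
  c≤a : ¬ a ℕ.< c
  c≤a a<c = <-contradiction (value (suc a))
    (≥-reflexive (cong₂ ℤ._-_ (coweight-≤ a<b) (coweight-< (ℕP.≤-refl {suc a}))))
    (ℤP.≤-reflexive (cong₂ ℤ._-_ (coweight-≤ (ℕP.≤-trans a<c (ℕP.<⇒≤ c<d))) (coweight-≤ a<c))) 0<1
... | diff {suc a} {b} 1≤a a<b b≤n | summ {c} {d} 1≤c c≤d d≤n =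
  ℕP.∸-monoʳ-≤ (suc n) (ℕP.≮⇒≥ b≤d) , ℕP.≤-trans (ℕP.m∸n≤m n a) (ℕP.m≤m+n n c)
  where
  ab = range-< 1≤a a<b b≤n
  cd = range-≤ 1≤c c≤d d≤n
  value : ∀ k → _
  value k = dot-mono-diff-sum k (proj₁ ab) (proj₂ ab) (proj₁ cd) (proj₂ cd)
    (subst₂ _≤Φ_ (alpha-diff 1≤a a<b b≤n) (alpha-summ 1≤c d≤n) α≤β)
  b≤d : ¬ d ℕ.< b
  b≤d d<b = <-contradiction (value b)
    (≥-reflexive (cong₂ ℤ._-_ (coweight-≤ (ℕP.≤-refl {b})) (coweight-< a<b)))
    (ℤP.≤-reflexive (cong₂ ℤ._+_ (coweight-< d<b) (coweight-< (ℕP.≤-<-trans c≤d d<b)))) 0<1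
... | summ {a} {b} 1≤a a≤b b≤n | diff {c} {d} 1≤c c<d d≤n =
  ⊥-elim (<-contradiction (value 1)
    (≥-reflexive (cong₂ ℤ._+_ (coweight-≤ (proj₁ (proj₂ ab))) (coweight-≤ 1≤a)))
    (ℤP.≤-reflexive (cong₂ ℤ._-_ (coweight-≤ (proj₁ (proj₂ cd))) (coweight-≤ 1≤c)))
    (ℤ.+<+ (s≤s z≤n)))
  where
  ab = range-≤ 1≤a a≤b b≤n
  cd = range-< 1≤c c<d d≤n
  value : ∀ k → _
  value k = dot-mono-sum-diff k (proj₁ ab) (proj₂ ab) (proj₁ cd) (proj₂ cd)
    (subst₂ _≤Φ_ (alpha-summ 1≤a b≤n) (alpha-diff 1≤c c<d d≤n) α≤β)
... | summ {a} {b} 1≤a a≤b b≤n | summ {c} {d} 1≤c c≤d d≤n =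
  ℕP.∸-monoʳ-≤ (suc n) (ℕP.≮⇒≥ b≤d) , ℕP.+-monoʳ-≤ n (ℕP.≮⇒≥ a≤c)
  where
  ab = range-≤ 1≤a a≤b b≤n
  cd = range-≤ 1≤c c≤d d≤n
  value : ∀ k → _
  value k = dot-mono-sum-sum k (proj₁ ab) (proj₂ ab) (proj₁ cd) (proj₂ cd)
    (subst₂ _≤Φ_ (alpha-summ 1≤a b≤n) (alpha-summ 1≤c d≤n) α≤β)
  b≤d : ¬ d ℕ.< b
  b≤d d<b = <-contradiction (value b)
    (ℤP.+-mono-≤ (≥-reflexive (coweight-≤ (ℕP.≤-refl {b}))) (coweight≥0 b a))
    (ℤP.≤-reflexive (cong₂ ℤ._+_ (coweight-< d<b) (coweight-< (ℕP.≤-<-trans c≤d d<b)))) 0<1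
  a≤c : ¬ c ℕ.< a
  a≤c c<a = <-contradiction (value a)
    (≥-reflexive (cong₂ ℤ._+_ (coweight-≤ a≤b) (coweight-≤ (ℕP.≤-refl {a}))))
    (ℤP.+-mono-≤ (coweight≤1 a d) (ℤP.≤-reflexive (coweight-< c<a)))
    (ℤ.+<+ (s≤s (s≤s z≤n)))

-- The action on roots

nthℤ : List ℤ → ℕ → ℤ
nthℤ [] _ = + 0
nthℤ (y ∷ ys) zero = + 0
nthℤ (y ∷ ys) (suc zero) = y
nthℤ (y ∷ ys) (suc (suc k)) = nthℤ ys (suc k)

-- The local lookup function of act cannot be named. The left-hand sides _ below are solved by terms containing it;
-- the with-abstractions separate its list argument from the parameters it inherits from act.
mutual
  act-nth : ∀ n w (x : Vec ℤ n) →
    act n w x ≡ vsum (map (λ i → (x ⟦ i ⟧) • eS n (nthℤ w i)) (oneTo n))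
  act-nth n w x = cong vsum (map-cong (wi-nth n w x) (oneTo n))

  wi-nth : ∀ n (w : List ℤ) (x : Vec ℤ n) i → _ ≡ (x ⟦ i ⟧) • eS n (nthℤ w i)
  wi-nth n [] x i = refl
  wi-nth n (y ∷ ys) x zero = refl
  wi-nth n (y ∷ ys) x (suc zero) = refl
  wi-nth n (y ∷ ys) x (suc (suc k)) with y ∷ ys | suc (suc k)
  ... | w | i = nth-suc n w x i ys k

  nth-suc : ∀ n (w : List ℤ) (x : Vec ℤ n) i ys k → _ ≡ (x ⟦ i ⟧) • eS n (nthℤ ys (suc k))
  nth-suc n w x i ys k with suc k
  ... | m = nth-nth n w x i ys m

  nth-nth : ∀ n (w : List ℤ) (x : Vec ℤ n) i ys m → _ ≡ (x ⟦ i ⟧) • eS n (nthℤ ys m)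
  nth-nth n w x i [] m = refl
  nth-nth n w x i (y ∷ ys) zero = refl
  nth-nth n w x i (y ∷ ys) (suc zero) = refl
  nth-nth n w x i (y ∷ ys) (suc (suc m)) = nth-nth n w x i ys (suc m)

-- Each coordinate of a linear combination is a functional of the coefficient vector. This lets
-- `dot-diff`, `dot-sum` and `dot-double` compute the action on roots.
lookup-combination : ∀ {n k} (V : ℕ → Vec ℤ n) (x : Vec ℤ k) m →
  lookup (vsum (map (λ i → (x ⟦ i ⟧) • V i) (oneTo k))) m ≡ dot (λ i → lookup (V i) m) x
lookup-combination V Vec.[] m = lookup-replicate m 0ℤ
lookup-combination {n} {suc k} V (x Vec.∷ xs) m = begin
  lookup (vsum (map f (oneTo (suc k)))) m
    ≡⟨ cong (λ is → lookup (vsum (map f is)) m) (oneTo-suc k) ⟩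
  lookup ((x • V 1) ⊕ vsum (map f (map suc (oneTo k)))) m
    ≡⟨ lookup-⊕ (x • V 1) _ m ⟩
  lookup (x • V 1) m ℤ.+ lookup (vsum (map f (map suc (oneTo k)))) m
    ≡⟨ cong₂ ℤ._+_ (lookup-• x (V 1) m) (cong (λ vs → lookup (vsum vs) m) tail≡) ⟩
  x ℤ.* lookup (V 1) m ℤ.+ lookup (vsum (map (λ i → (xs ⟦ i ⟧) • V (suc i)) (oneTo k))) m
    ≡⟨ cong (λ s → x ℤ.* lookup (V 1) m ℤ.+ s) (lookup-combination (V ∘ suc) xs m) ⟩
  x ℤ.* lookup (V 1) m ℤ.+ dot (λ i → lookup (V (suc i)) m) xs ∎
  where
  open ≡-Reasoning
  f : ℕ → Vec ℤ n
  f i = ((x Vec.∷ xs) ⟦ i ⟧) • V i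
  tail≡ : map f (map suc (oneTo k)) ≡ map (λ i → (xs ⟦ i ⟧) • V (suc i)) (oneTo k)
  tail≡ = trans (sym (map-∘ (oneTo k))) (trans (sym (map-∘ (upTo k))) (map-∘ (upTo k)))

lookup-act : ∀ {n} w (x : Vec ℤ n) m → lookup (act n w x) m ≡ dot (λ i → lookup (eS n (nthℤ w i)) m) x
lookup-act {n} w x m =
  trans (cong (λ v → lookup v m) (act-nth n w x)) (lookup-combination (λ i → eS n (nthℤ w i)) x m)

module _ {n : ℕ} (w : List ℤ) {a b : ℕ} (a∈ : InRange n a) (b∈ : InRange n b) where

  act-diff : act n w (e n b ⊖ e n a) ≡ eS n (nthℤ w b) ⊖ eS n (nthℤ w a)
  act-diff = vec-ext λ m → trans (lookup-act w (e n b ⊖ e n a) m)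
    (trans (dot-diff _ a∈ b∈) (sym (lookup-⊖ (eS n (nthℤ w b)) _ m)))

  act-sum : act n w (e n a ⊕ e n b) ≡ eS n (nthℤ w a) ⊕ eS n (nthℤ w b)
  act-sum = vec-ext λ m → trans (lookup-act w (e n a ⊕ e n b) m)
    (trans (dot-sum _ a∈ b∈) (sym (lookup-⊕ (eS n (nthℤ w a)) _ m)))

act-double : ∀ {n} w {a} → InRange n a → act n w ((+ 2) • e n a) ≡ (+ 2) • eS n (nthℤ w a)
act-double {n} w {a} a∈ = vec-ext λ m → trans (lookup-act w ((+ 2) • e n a) m)
  (trans (dot-double _ a∈) (sym (lookup-• (+ 2) (eS n (nthℤ w a)) m)))

SignedIndex : ℕ → ℤ → Set
SignedIndex n p = p ≢ 0ℤ × ∣ p ∣ ≤ n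

eS-neg : ∀ {n p} → p ≢ 0ℤ → eS n (- p) ≡ (- 1ℤ) • eS n p
eS-neg {p = + 0} p≢0 = ⊥-elim (p≢0 refl)
eS-neg {p = +[1+ k ]} _ = refl
eS-neg {n} { -[1+ k ]} _ = vec-ext λ m → sym (trans (lookup-• (- 1ℤ) ((- 1ℤ) • e n (suc k)) m)
  (trans (cong ((- 1ℤ) ℤ.*_) (lookup-• (- 1ℤ) (e n (suc k)) m)) (neg-neg (lookup (e n (suc k)) m))))
  where
  neg-neg : ∀ x → (- 1ℤ) ℤ.* ((- 1ℤ) ℤ.* x) ≡ x
  neg-neg = solve-∀

⊖-neg : ∀ {n} (x y : Vec ℤ n) → x ⊖ ((- 1ℤ) • y) ≡ x ⊕ y
⊖-neg x y = vec-ext λ m → trans (lookup-⊖ x _ m)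
  (trans (cong (λ s → lookup x m ℤ.- s) (lookup-• (- 1ℤ) y m))
    (trans (sub-neg (lookup x m) (lookup y m)) (sym (lookup-⊕ x y m))))
  where
  sub-neg : ∀ x y → x ℤ.- (- 1ℤ) ℤ.* y ≡ x ℤ.+ y
  sub-neg = solve-∀

neg-⊖-neg : ∀ {n} (x y : Vec ℤ n) → ((- 1ℤ) • x) ⊖ ((- 1ℤ) • y) ≡ y ⊖ x
neg-⊖-neg x y = vec-ext λ m → trans (lookup-⊖ ((- 1ℤ) • x) ((- 1ℤ) • y) m)
  (trans (cong₂ ℤ._-_ (lookup-• (- 1ℤ) x m) (lookup-• (- 1ℤ) y m))
    (trans (swap (lookup x m) (lookup y m)) (sym (lookup-⊖ y x m))))
  where
  swap : ∀ x y → (- 1ℤ) ℤ.* x ℤ.- (- 1ℤ) ℤ.* y ≡ y ℤ.- x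
  swap = solve-∀

-- `eS` turns a sign of the index into a sign of the vector, so the integer order covers all shapes:
-- two positive indices give a difference, mixed signs a sum (a double if the absolute values
-- agree), two negative indices the reversed difference.
eS-diff∈posRoots : ∀ {n p q} → SignedIndex n p → SignedIndex n q → q ℤ.< p → eS n p ⊖ eS n q ∈ posRoots n
eS-diff∈posRoots {p = + 0} (p≢0 , _) _ _ = ⊥-elim (p≢0 refl)
eS-diff∈posRoots {q = + 0} _ (q≢0 , _) _ = ⊥-elim (q≢0 refl)
eS-diff∈posRoots {n} {+[1+ k ]} {+[1+ l ]} (_ , k<n) _ (ℤ.+<+ l<k) = diff∈posRoots (s≤s z≤n) l<k k<n
eS-diff∈posRoots {n} {+[1+ k ]} { -[1+ l ]} (_ , k<n) (_ , l<n) _ =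
  subst (_∈ posRoots n) (sym (⊖-neg (e n (suc k)) (e n (suc l))))
    (sum∈posRoots′ (s≤s z≤n , k<n) (s≤s z≤n , l<n))
eS-diff∈posRoots {n} { -[1+ k ]} { -[1+ l ]} _ (_ , l<n) (ℤ.-<- k<l) =
  subst (_∈ posRoots n) (sym (neg-⊖-neg (e n (suc k)) (e n (suc l))))
    (diff∈posRoots (s≤s z≤n) (s≤s k<l) l<n)

-- For `p < q` the opposite vector is a positive root, and the two values under `dot +_` would be
-- positive with sum 0.
eS-diff∉posRoots : ∀ {n p q} → SignedIndex n p → SignedIndex n q → p ℤ.≤ q → ¬ eS n p ⊖ eS n q ∈ posRoots n
eS-diff∉posRoots {n} {p} {q} p∈ q∈ p≤q pq∈ with ℤP.<-cmp p q
... | tri> _ _ q<p = ℤP.<⇒≱ q<p p≤q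
... | tri≈ _ refl _ = ℤP.<-irrefl refl (subst (0ℤ ℤ.<_)
        (trans (cong (dot +_) (x⊖x≡0 (eS n p))) (dot-vzero n +_)) (height>0 pq∈))
... | tri< p<q _ _ = ℤP.<-irrefl refl (subst (0ℤ ℤ.<_) cancel
        (ℤP.+-mono-< (height>0 pq∈) (height>0 (eS-diff∈posRoots q∈ p∈ p<q))))
  where
  sub-sub : ∀ x y → (x ℤ.- y) ℤ.+ (y ℤ.- x) ≡ 0ℤ
  sub-sub = solve-∀
  cancel : dot +_ (eS n p ⊖ eS n q) ℤ.+ dot +_ (eS n q ⊖ eS n p) ≡ 0ℤ
  cancel = trans (cong₂ ℤ._+_ (dot-⊖ +_ (eS n p) (eS n q)) (dot-⊖ +_ (eS n q) (eS n p)))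
    (sub-sub (dot +_ (eS n p)) (dot +_ (eS n q)))

SignedIndex-neg : ∀ {n p} → SignedIndex n p → SignedIndex n (- p)
SignedIndex-neg {n} {p} (p≢0 , p≤n) =
  (λ -p≡0 → p≢0 (trans (sym (ℤP.neg-involutive p)) (cong -_ -p≡0))) , subst (_≤ n) (sym (ℤP.∣-i∣≡∣i∣ p)) p≤n

eS-sum≡diff : ∀ {n p q} → SignedIndex n q → eS n p ⊕ eS n q ≡ eS n p ⊖ eS n (- q)
eS-sum≡diff {n} {p} {q} q∈ = sym (trans (cong (eS n p ⊖_) (eS-neg {n} {q} (proj₁ q∈))) (⊖-neg (eS n p) (eS n q)))

eS-double∈posRoots : ∀ {n p} → SignedIndex n p → 0ℤ ℤ.< p → (+ 2) • eS n p ∈ posRoots n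
eS-double∈posRoots {p = + 0} (p≢0 , _) _ = ⊥-elim (p≢0 refl)
eS-double∈posRoots {p = +[1+ k ]} (_ , k<n) _ = double∈posRoots (s≤s z≤n , k<n)

-- Twice `eS n p` is `eS n p ⊖ eS n (- p)`, and `p ≤ 0 ≤ - p`.
eS-double∉posRoots : ∀ {n p} → SignedIndex n p → p ℤ.≤ 0ℤ → ¬ (+ 2) • eS n p ∈ posRoots n
eS-double∉posRoots {n} {p} p∈ p≤0 2p∈ = eS-diff∉posRoots {n} {p} { - p} p∈ (SignedIndex-neg p∈)
  (ℤP.≤-trans p≤0 (ℤP.neg-mono-≤ p≤0))
  (subst (_∈ posRoots n) (trans (x⊕x≡2•x (eS n p)) (eS-sum≡diff {n} {p} p∈)) 2p∈)

-- Positions in lists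

infix 4 _[_]≡_

-- Positions count from zero and a missing entry needs no default; `nthℕ` and `nthℤ` count from one
-- and return 0 out of range.
data _[_]≡_ {A : Set} : List A → ℕ → A → Set where
  here  : ∀ {x xs} → (x ∷ xs) [ 0 ]≡ x
  there : ∀ {x xs k y} → xs [ k ]≡ y → (x ∷ xs) [ suc k ]≡ y

[]≡⇒∈ : ∀ {A : Set} {xs : List A} {k y} → xs [ k ]≡ y → y ∈ xs
[]≡⇒∈ here = here refl
[]≡⇒∈ (there p) = there ([]≡⇒∈ p)

[]≡⇒< : ∀ {A : Set} {xs : List A} {k y} → xs [ k ]≡ y → k ℕ.< length xs
[]≡⇒< here = s≤s z≤n
[]≡⇒< (there p) = s≤s ([]≡⇒< p)

<⇒[]≡ : ∀ {A : Set} (xs : List A) {k} → k ℕ.< length xs → ∃[ y ] xs [ k ]≡ y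
<⇒[]≡ (x ∷ xs) {zero} _ = x , here
<⇒[]≡ (x ∷ xs) {suc k} (s≤s k<) with y , p ← <⇒[]≡ xs k< = y , there p

[]≡-functional : ∀ {A : Set} {xs : List A} {k y z} → xs [ k ]≡ y → xs [ k ]≡ z → y ≡ z
[]≡-functional here here = refl
[]≡-functional (there p) (there q) = []≡-functional p q

[]≡-map⁺ : ∀ {A B : Set} (f : A → B) {xs k y} → xs [ k ]≡ y → map f xs [ k ]≡ f y
[]≡-map⁺ f here = here
[]≡-map⁺ f (there p) = there ([]≡-map⁺ f p)

[]≡-++⁺ˡ : ∀ {A : Set} {xs : List A} ys {k y} → xs [ k ]≡ y → (xs ++ ys) [ k ]≡ y
[]≡-++⁺ˡ ys here = here
[]≡-++⁺ˡ ys (there p) = there ([]≡-++⁺ˡ ys p)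

[]≡-++⁺ʳ : ∀ {A : Set} (xs : List A) {ys k y} → ys [ k ]≡ y → (xs ++ ys) [ length xs ℕ.+ k ]≡ y
[]≡-++⁺ʳ [] p = p
[]≡-++⁺ʳ (x ∷ xs) p = there ([]≡-++⁺ʳ xs p)

[]≡-++⁻ : ∀ {A : Set} (xs : List A) {ys k y} → (xs ++ ys) [ k ]≡ y →
  xs [ k ]≡ y ⊎ (length xs ≤ k × y ∈ ys)
[]≡-++⁻ [] p = inj₂ (z≤n , []≡⇒∈ p)
[]≡-++⁻ (x ∷ xs) here = inj₁ here
[]≡-++⁻ (x ∷ xs) (there p) with []≡-++⁻ xs p
... | inj₁ q = inj₁ (there q)
... | inj₂ (le , y∈) = inj₂ (s≤s le , y∈)

-- Labelled words and their valleys

module _ {L : Set} where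

  pick : Step → List (Step × L) → List L
  pick s [] = []
  pick N ((N , l) ∷ w) = l ∷ pick N w
  pick N ((E , l) ∷ w) = pick N w
  pick E ((N , l) ∷ w) = pick E w
  pick E ((E , l) ∷ w) = l ∷ pick E w

  pick-++ : ∀ s v w → pick s (v ++ w) ≡ pick s v ++ pick s w
  pick-++ s [] w = refl
  pick-++ N ((N , l) ∷ v) w = cong (l ∷_) (pick-++ N v w)
  pick-++ N ((E , l) ∷ v) w = pick-++ N v w
  pick-++ E ((N , l) ∷ v) w = pick-++ E v w
  pick-++ E ((E , l) ∷ v) w = cong (l ∷_) (pick-++ E v w)

  ∈-pick : ∀ s {w l} → l ∈ pick s w → (s , l) ∈ w
  ∈-pick N {(N , _) ∷ w} (here refl) = here refl
  ∈-pick N {(N , _) ∷ w} (there l∈) = there (∈-pick N l∈)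
  ∈-pick N {(E , _) ∷ w} l∈ = there (∈-pick N l∈)
  ∈-pick E {(N , _) ∷ w} l∈ = there (∈-pick E l∈)
  ∈-pick E {(E , _) ∷ w} (here refl) = here refl
  ∈-pick E {(E , _) ∷ w} (there l∈) = there (∈-pick E l∈)

  valleyAt : ℕ → ℕ → List (Step × L) → ℕ × ℕ
  valleyAt ne nn w = suc (ne ℕ.+ length (pick E w)) , suc (nn ℕ.+ length (pick N w))

  -- Both coordinates of a valley are determined by the prefix before its E. A final E fits the same
  -- formula, the absent N counting as the next one.
  valley⇒split : ∀ ne nn w {v} → v ∈ valleysAux ne nn (map proj₁ w) →
    ∃[ x ] ∃[ l ] ∃[ y ] (w ≡ x ++ (E , l) ∷ y × v ≡ valleyAt ne nn x)
  valley⇒split ne nn ((N , l) ∷ w) v∈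
    with x , m , y , refl , refl ← valley⇒split ne (suc nn) w v∈
    = (N , l) ∷ x , m , y , refl , cong₂ _,_ refl (cong suc (sym (ℕP.+-suc nn _)))
  valley⇒split ne nn ((E , l) ∷ []) (here refl) =
    [] , l , [] , refl , cong₂ _,_ (cong suc (sym (ℕP.+-identityʳ ne))) (cong suc (sym (ℕP.+-identityʳ nn)))
  valley⇒split ne nn ((E , l) ∷ (N , m) ∷ w) (here refl) =
    [] , l , (N , m) ∷ w , refl ,
    cong₂ _,_ (cong suc (sym (ℕP.+-identityʳ ne))) (cong suc (sym (ℕP.+-identityʳ nn)))
  valley⇒split ne nn ((E , l) ∷ (N , m) ∷ w) (there v∈)
    with x , o , y , eq , refl ← valley⇒split (suc ne) nn ((N , m) ∷ w) v∈
    = (E , l) ∷ x , o , y , cong ((E , l) ∷_) eq , cong₂ _,_ (cong suc (sym (ℕP.+-suc ne _))) refl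
  valley⇒split ne nn ((E , l) ∷ (E , m) ∷ w) v∈
    with x , o , y , eq , refl ← valley⇒split (suc ne) nn ((E , m) ∷ w) v∈
    = (E , l) ∷ x , o , y , cong ((E , l) ∷_) eq , cong₂ _,_ (cong suc (sym (ℕP.+-suc ne _))) refl

  -- Following the run of E's to its last letter reaches a valley; on the way the first coordinate
  -- can only grow and the second does not change.
  split⇒valley : ∀ ne nn x l y →
    ∃[ v ] (v ∈ valleysAux ne nn (map proj₁ (x ++ (E , l) ∷ y)) × v ≤Cell valleyAt ne nn x)
  split⇒valley ne nn [] l [] = _ , here refl , start
    where
    start : (suc ne , suc nn) ≤Cell (suc (ne ℕ.+ 0) , suc (nn ℕ.+ 0))
    start = s≤s (ℕP.≤-reflexive (ℕP.+-identityʳ ne)) , s≤s (ℕP.m≤m+n nn 0)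
  split⇒valley ne nn [] l ((N , m) ∷ y) = _ , here refl ,
    (s≤s (ℕP.≤-reflexive (ℕP.+-identityʳ ne)) , s≤s (ℕP.m≤m+n nn 0))
  split⇒valley ne nn [] l ((E , m) ∷ y)
    with v , v∈ , (le , ge) ← split⇒valley (suc ne) nn [] m y
    = v , v∈ , (ℕP.≤-trans (ℕP.n≤1+n _) le , ge)
  split⇒valley ne nn ((N , m) ∷ x) l y
    with v , v∈ , (le , ge) ← split⇒valley ne (suc nn) x l y
    = v , v∈ , (le , ℕP.≤-trans ge (s≤s (ℕP.≤-reflexive (sym (ℕP.+-suc nn _)))))
  split⇒valley ne nn ((E , m) ∷ []) l y
    with v , v∈ , (le , ge) ← split⇒valley (suc ne) nn [] l y
    = v , v∈ , (ℕP.≤-trans (s≤s (ℕP.≤-reflexive (ℕP.+-suc ne _))) le , ge)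
  split⇒valley ne nn ((E , m) ∷ (N , o) ∷ x) l y
    with v , v∈ , (le , ge) ← split⇒valley (suc ne) nn ((N , o) ∷ x) l y
    = v , there v∈ , (ℕP.≤-trans (s≤s (ℕP.≤-reflexive (ℕP.+-suc ne _))) le , ge)
  split⇒valley ne nn ((E , m) ∷ (E , o) ∷ x) l y
    with v , v∈ , (le , ge) ← split⇒valley (suc ne) nn ((E , o) ∷ x) l y
    = v , v∈ , (ℕP.≤-trans (s≤s (ℕP.≤-reflexive (ℕP.+-suc ne _))) le , ge)

  pickE⇒split : ∀ w {i l} → pick E w [ i ]≡ l →
    ∃[ x ] ∃[ y ] (w ≡ x ++ (E , l) ∷ y × length (pick E x) ≡ i)
  pickE⇒split ((N , m) ∷ w) p with x , y , refl , eq ← pickE⇒split w p = (N , m) ∷ x , y , refl , eq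
  pickE⇒split ((E , m) ∷ w) here = [] , w , refl , refl
  pickE⇒split ((E , m) ∷ w) (there p)
    with x , y , refl , eq ← pickE⇒split w p = (E , m) ∷ x , y , refl , cong suc eq

  module _ (_≺_ : L → L → Set) (≺-trans : ∀ {k l m} → k ≺ l → l ≺ m → k ≺ m) (≺-irrefl : ∀ {l} → ¬ l ≺ l) where

    Sorted : List (Step × L) → Set
    Sorted = AllPairs (λ k l → proj₂ k ≺ proj₂ l)

    sorted-before : ∀ x {k y s m} → Sorted (x ++ k ∷ y) → (s , m) ∈ x → m ≺ proj₂ k
    sorted-before (_ ∷ x) (all ∷ _) (here refl) = All.lookup all (∈-++⁺ʳ x (here refl))
    sorted-before (_ ∷ x) (_ ∷ sorted) (there m∈) = sorted-before x sorted m∈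

    sorted-after : ∀ x {k y s m} → Sorted (x ++ k ∷ y) → (s , m) ∈ y → proj₂ k ≺ m
    sorted-after [] (all ∷ _) m∈ = All.lookup all m∈
    sorted-after (_ ∷ x) (_ ∷ sorted) m∈ = sorted-after x sorted m∈

    module _ (x : List (Step × L)) {l : L} {y : List (Step × L)} (sorted : Sorted (x ++ (E , l) ∷ y)) where

      private w = x ++ (E , l) ∷ y

      pickN-order : ∀ {j m} → pick N w [ j ]≡ m →
        (j ℕ.< length (pick N x) × m ≺ l) ⊎ (length (pick N x) ≤ j × l ≺ m)
      pickN-order {j} {m} p with []≡-++⁻ (pick N x) (subst (_[ j ]≡ m) (pick-++ N x ((E , l) ∷ y)) p)
      ... | inj₁ q = inj₁ ([]≡⇒< q , sorted-before x sorted (∈-pick N ([]≡⇒∈ q)))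
      ... | inj₂ (le , m∈) = inj₂ (le , sorted-after x sorted (∈-pick N m∈))

      pickE-order : ∀ {i m} → pick E w [ i ]≡ m → i ≤ length (pick E x) → m ≡ l ⊎ m ≺ l
      pickE-order {i} {m} p i≤ with subst (_[ i ]≡ m) (pick-++ E x ((E , l) ∷ y)) p
      ... | q with ℕP.m≤n⇒m<n∨m≡n i≤
      ...   | inj₂ refl = inj₁ ([]≡-functional q
              (subst ((pick E x ++ l ∷ pick E y) [_]≡ l) (ℕP.+-identityʳ _) ([]≡-++⁺ʳ (pick E x) here)))
      ...   | inj₁ i< with []≡-++⁻ (pick E x) q
      ...     | inj₁ r = inj₂ (sorted-before x sorted (∈-pick E ([]≡⇒∈ r)))
      ...     | inj₂ (le , _) = ⊥-elim (ℕP.<⇒≱ i< le)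

    module _ {w : List (Step × L)} (sorted : Sorted w) where

      -- `i` and `j` are zero-based positions in `pick E w` and `pick N w`, whereas cells are
      -- one-based.
      ValleyBelow : ℕ → ℕ → Set
      ValleyBelow i j = ∃[ v ] (v ∈ valleys (map proj₁ w) × v ≤Cell (suc i , suc j))

      -- A valley below would come from an E at or after position `i` with at most `j` N's before
      -- it. That E would precede the N labelled `m`, which precedes the E at position `i`.
      noValleyBelow : ∀ {i j m} → pick N w [ j ]≡ m →
        length (pick E w) ≤ i ⊎ (∃[ l ] (pick E w [ i ]≡ l × m ≺ l)) → ¬ ValleyBelow i j
      noValleyBelow {i} {j} {m} mAt noE (v , v∈ , i≤v , v≤j)
        with x , k , y , refl , refl ← valley⇒split 0 0 w v∈
        with pickN-order x sorted mAt
      ... | inj₁ (j< , _) = ℕP.<⇒≱ j< (ℕP.≤-pred v≤j)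
      ... | inj₂ (_ , k≺m) with noE
      ...   | inj₁ |E|≤i = ℕP.<⇒≱ (ℕP.m<m+n (length (pick E x)) (s≤s z≤n)) (ℕP.≤-trans
                (ℕP.≤-reflexive (trans (sym (length-++ (pick E x))) (cong length (sym (pick-++ E x ((E , k) ∷ y))))))
                (ℕP.≤-trans |E|≤i (ℕP.≤-pred i≤v)))
      ...   | inj₂ (l , lAt , m≺l) with pickE-order x sorted lAt (ℕP.≤-pred i≤v)
      ...     | inj₁ refl = ≺-irrefl (≺-trans m≺l k≺m)
      ...     | inj₂ l≺k = ≺-irrefl (≺-trans m≺l (≺-trans l≺k k≺m))

      -- The valley closing the run that contains the E labelled `l` is a witness: at most `j` N's
      -- precede this run.
      valleyBelow : ∀ {i j l} → pick E w [ i ]≡ l →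
        length (pick N w) ≤ j ⊎ (∃[ m ] (pick N w [ j ]≡ m × l ≺ m)) → ValleyBelow i j
      valleyBelow {i} {j} {l} lAt noN with x , y , refl , refl ← pickE⇒split w lAt
        with v , v∈ , le , ge ← split⇒valley 0 0 x l y
        = v , v∈ , le , ℕP.≤-trans ge (s≤s (|N|≤j noN))
        where
        |N|≤j : length (pick N w) ≤ j ⊎ (∃[ m ] (pick N w [ j ]≡ m × l ≺ m)) → length (pick N x) ≤ j
        |N|≤j (inj₁ le) = ℕP.≤-trans (ℕP.m≤m+n _ _) (ℕP.≤-trans
          (ℕP.≤-reflexive (trans (sym (length-++ (pick N x))) (cong length (sym (pick-++ N x ((E , l) ∷ y)))))) le)
        |N|≤j (inj₂ (m , mAt , l≺m)) with pickN-order x sorted mAt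
        ... | inj₁ (_ , m≺l) = ⊥-elim (≺-irrefl (≺-trans m≺l l≺m))
        ... | inj₂ (le , _) = le

      valley-cell : ∀ {n v} → length (pick E w) ≤ n → length (pick E w) ℕ.+ length (pick N w) ≤ n ℕ.+ n →
        (∀ {i l} → pick E w [ i ]≡ l → ∃[ m ] (pick N w [ i ]≡ m × m ≺ l)) →
        v ∈ valleys (map proj₁ w) → Cell n v
      valley-cell {n} |E|≤n |w|≤2n ballot v∈ with x , l , y , refl , refl ← valley⇒split 0 0 w v∈ =
        s≤s z≤n , ℕP.≤-trans E< |E|≤n , s≤s EN , s≤s (ℕP.≤-trans sum≤ |w|≤2n)
        where
        E-eq : pick E w ≡ pick E x ++ l ∷ pick E y
        E-eq = pick-++ E x ((E , l) ∷ y)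
        lAt : pick E w [ length (pick E x) ]≡ l
        lAt = subst₂ (_[_]≡ l) (sym E-eq) (ℕP.+-identityʳ _) ([]≡-++⁺ʳ (pick E x) here)
        E< : length (pick E x) ℕ.< length (pick E w)
        E< = []≡⇒< lAt
        N≤ : length (pick N x) ≤ length (pick N w)
        N≤ = ℕP.≤-trans (ℕP.m≤m+n _ _)
          (ℕP.≤-reflexive (trans (sym (length-++ (pick N x))) (cong length (sym (pick-++ N x ((E , l) ∷ y))))))
        -- The E after `x` is not counted in `x`; it pays for the successor.
        sum≤ : length (pick E x) ℕ.+ suc (length (pick N x)) ≤ length (pick E w) ℕ.+ length (pick N w)
        sum≤ = ℕP.≤-trans (ℕP.≤-reflexive (ℕP.+-suc _ _)) (ℕP.+-mono-≤ E< N≤)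
        -- By the ballot hypothesis, the N with the same position as this E stands before it, hence
        -- inside `x`.
        EN : length (pick E x) ℕ.< length (pick N x)
        EN with m , mAt , m≺l ← ballot lAt with pickN-order x sorted mAt
        ... | inj₁ (lt , _) = lt
        ... | inj₂ (_ , l≺m) = ⊥-elim (≺-irrefl (≺-trans l≺m m≺l))

-- The zeta word as a labelled word

filter-reverse : ∀ {A : Set} {P : A → Set} (P? : ∀ x → Dec (P x)) xs →
  filter P? (reverse xs) ≡ reverse (filter P? xs)
filter-reverse P? [] = refl
filter-reverse P? (x ∷ xs) = begin
  filter P? (reverse (x ∷ xs))                    ≡⟨ cong (filter P?) (unfold-reverse x xs) ⟩
  filter P? (reverse xs ++ x ∷ [])                ≡⟨ filter-++ P? (reverse xs) (x ∷ []) ⟩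
  filter P? (reverse xs) ++ filter P? (x ∷ [])    ≡⟨ cong (_++ filter P? (x ∷ [])) (filter-reverse P? xs) ⟩
  reverse (filter P? xs) ++ filter P? (x ∷ [])    ≡⟨ last-step ⟩
  reverse (filter P? (x ∷ xs))                    ∎
  where
  open ≡-Reasoning
  last-step : reverse (filter P? xs) ++ filter P? (x ∷ []) ≡ reverse (filter P? (x ∷ xs))
  last-step with does (P? x)
  ... | true = sym (unfold-reverse x (filter P? xs))
  ... | false = ++-identityʳ _

[]≡-AllPairs : ∀ {A : Set} {R : A → A → Set} {xs i j x y} → AllPairs R xs →
  xs [ i ]≡ x → xs [ j ]≡ y → i ℕ.< j → R x y
[]≡-AllPairs (all ∷ _) here (there q) _ = All.lookup all ([]≡⇒∈ q)
[]≡-AllPairs (_ ∷ ap) (there p) (there q) (s≤s i<j) = []≡-AllPairs ap p q i<j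

oneTo-sorted : ∀ n → AllPairs ℕ._<_ (oneTo n)
oneTo-sorted n = AllPairsP.map⁺ (AllPairsP.applyUpTo⁺₁ (λ i → i) n (λ i<j _ → s≤s i<j))

reverse-oneTo-sorted : ∀ n → AllPairs ℕ._>_ (reverse (oneTo n))
reverse-oneTo-sorted n = subst (AllPairs ℕ._>_) (sym rev≡)
  (AllPairsP.map⁺ (AllPairsP.applyDownFrom⁺₁ (λ i → i) n (λ j<i _ → s≤s j<i)))
  where
  rev≡ : reverse (oneTo n) ≡ map suc (downFrom n)
  rev≡ = trans (sym (reverse-map suc (upTo n))) (cong (map suc) (reverse-upTo n))

-- Doubling by recursion, so that `ReadBefore (dbl k)` unfolds together with `k` along the
-- period-two clause.
dbl : ℕ → ℕ
dbl zero = zero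
dbl (suc k) = suc (suc (dbl k))

-- Block 2k of the zeta word is S⃗⁺ k and block 2k + 1 is S⃖⁻ k.
-- In terms of the sequence c₁ , … , cₙ the even blocks are read right to left, the odd ones left to right.
ReadBefore : ℕ → ℕ → ℕ → Set
ReadBefore zero i j = j ℕ.< i
ReadBefore (suc zero) i j = i ℕ.< j
ReadBefore (suc (suc t)) = ReadBefore t

infix 4 _≺_

-- Compares keys (index, block). The zeta word starts with its highest block, hence the reversed
-- comparison of blocks.
_≺_ : ℕ × ℕ → ℕ × ℕ → Set
(i , s) ≺ (j , t) = t ℕ.< s ⊎ (s ≡ t × ReadBefore t i j)

ReadBefore-trans : ∀ t {i j k} → ReadBefore t i j → ReadBefore t j k → ReadBefore t i k
ReadBefore-trans zero p q = ℕP.<-trans q p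
ReadBefore-trans (suc zero) p q = ℕP.<-trans p q
ReadBefore-trans (suc (suc t)) p q = ReadBefore-trans t p q

ReadBefore-irrefl : ∀ t {i} → ¬ ReadBefore t i i
ReadBefore-irrefl zero = ℕP.<-irrefl refl
ReadBefore-irrefl (suc zero) = ℕP.<-irrefl refl
ReadBefore-irrefl (suc (suc t)) = ReadBefore-irrefl t

≺-trans : ∀ {k l m} → k ≺ l → l ≺ m → k ≺ m
≺-trans (inj₁ p) (inj₁ q) = inj₁ (ℕP.<-trans q p)
≺-trans (inj₁ p) (inj₂ (refl , _)) = inj₁ p
≺-trans (inj₂ (refl , _)) (inj₁ q) = inj₁ q
≺-trans {m = _ , t} (inj₂ (refl , p)) (inj₂ (refl , q)) = inj₂ (refl , ReadBefore-trans t p q)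

≺-irrefl : ∀ {l} → ¬ l ≺ l
≺-irrefl (inj₁ p) = ℕP.<-irrefl refl p
≺-irrefl {_ , t} (inj₂ (_ , p)) = ReadBefore-irrefl t p

ReadBefore-even : ∀ k {i j} → j ℕ.< i → ReadBefore (dbl k) i j
ReadBefore-even zero p = p
ReadBefore-even (suc k) p = ReadBefore-even k p

ReadBefore-odd : ∀ k {i j} → i ℕ.< j → ReadBefore (suc (dbl k)) i j
ReadBefore-odd zero p = p
ReadBefore-odd (suc k) p = ReadBefore-odd k p

-- The block containing the (first) N contributed by an entry of the sequence.
level : ℤ → ℕ
level (+ zero) = 1
level +[1+ k ] = dbl (suc k)
level -[1+ k ] = suc (dbl (suc k))

pick-sorted : ∀ s {w : List (Step × (ℕ × ℕ))} → Sorted _≺_ ≺-trans ≺-irrefl w → AllPairs _≺_ (pick s w)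
pick-sorted s [] = []
pick-sorted N {(N , _) ∷ w} (all ∷ ap) = All.tabulate (All.lookup all ∘ ∈-pick N) ∷ pick-sorted N ap
pick-sorted N {(E , _) ∷ w} (all ∷ ap) = pick-sorted N ap
pick-sorted E {(N , _) ∷ w} (all ∷ ap) = pick-sorted E ap
pick-sorted E {(E , _) ∷ w} (all ∷ ap) = All.tabulate (All.lookup all ∘ ∈-pick E) ∷ pick-sorted E ap

module _ (n : ℕ) (c : ℕ → ℤ) where

  private
    up = oneTo n
    dn = reverse (oneTo n)

  level-set : ℤ → List ℕ → List ℕ
  level-set x = filter (λ j → c j ℤ.≟ x)

  block : ℕ → ℤ → ℤ → List ℕ → List (Step × (ℕ × ℕ))
  block t p q = concatMap (λ j → map (λ s → s , (j , t)) (letter p q (c j)))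

  map-proj₁-block : ∀ t p q js → map proj₁ (block t p q js) ≡ concatMap (letter p q) (map c js)
  map-proj₁-block t p q [] = refl
  map-proj₁-block t p q (j ∷ js) = trans (map-++ proj₁ (map _ (letter p q (c j))) _)
    (cong₂ _++_ (trans (sym (map-∘ (letter p q (c j)))) (map-id (letter p q (c j)))) (map-proj₁-block t p q js))

  pickN-block : ∀ t p q js → pick N (block t p q js) ≡ map (_, t) (level-set p js)
  pickN-block t p q [] = refl
  pickN-block t p q (j ∷ js) with does (c j ℤ.≟ p) | does (c j ℤ.≟ q)
  ... | true  | _     = cong ((j , t) ∷_) (pickN-block t p q js)
  ... | false | true  = pickN-block t p q js
  ... | false | false = pickN-block t p q js

  -- `letter p q` tests `p` first, so for `p ≡ q` every E would be lost.
  pickE-block : ∀ t p q js → p ≢ q → pick E (block t p q js) ≡ map (_, t) (level-set q js)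
  pickE-block t p q [] p≢q = refl
  pickE-block t p q (j ∷ js) p≢q with c j ℤ.≟ p | c j ℤ.≟ q
  ... | yes c≡p | yes c≡q = ⊥-elim (p≢q (trans (sym c≡p) c≡q))
  ... | yes _   | no _    = pickE-block t p q js p≢q
  ... | no _    | yes _   = cong ((j , t) ∷_) (pickE-block t p q js p≢q)
  ... | no _    | no _    = pickE-block t p q js p≢q

  block-all : ∀ t p q {js} (P : ℕ × ℕ → Set) → All (λ j → P (j , t)) js → All (P ∘ proj₂) (block t p q js)
  block-all t p q P [] = []
  block-all t p q {j ∷ js} P (pj ∷ pjs) =
    AllP.++⁺ (AllP.map⁺ (All.universal (λ _ → pj) (letter p q (c j)))) (block-all t p q P pjs)

  block-sorted : ∀ t p q {js} → AllPairs (ReadBefore t) js → Sorted _≺_ ≺-trans ≺-irrefl (block t p q js)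
  block-sorted t p q [] = []
  block-sorted t p q {j ∷ js} (all ∷ ap) = AllPairsP.++⁺ single (block-sorted t p q ap)
    (AllP.map⁺ (All.universal (λ _ → block-all t p q ((j , t) ≺_) (All.map (λ r → inj₂ (refl , r)) all)) (letter p q (c j))))
    where
    single : AllPairs (λ k l → proj₂ k ≺ proj₂ l) (map (λ s → s , (j , t)) (letter p q (c j)))
    single with eqℤ (c j) p | eqℤ (c j) q
    ... | true  | _     = [] ∷ []
    ... | false | true  = [] ∷ []
    ... | false | false = []

  block⁻ block⁺ : ℕ → List (Step × (ℕ × ℕ))
  block⁻ k = block (suc (dbl k)) (- (+ k)) (- (+ suc k)) up
  block⁺ k = block (dbl k) (+ k) (+ suc k) dn

  zetaWord : ℕ → List (Step × (ℕ × ℕ))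
  zetaWord zero = block⁻ 0 ++ block⁺ 0
  zetaWord (suc k) = (block⁻ (suc k) ++ block⁺ (suc k)) ++ zetaWord k

  map-proj₁-zetaWord : ∀ {a} → a ≡ map c dn → ∀ k → map proj₁ (zetaWord k) ≡ zetaAux a k
  map-proj₁-zetaWord {a} a≡ = go
    where
    a-rev : reverse a ≡ map c up
    a-rev = trans (cong reverse a≡) (trans (sym (reverse-map c dn)) (cong (map c) (reverse-involutive up)))
    blocks : ∀ k → map proj₁ (block⁻ k ++ block⁺ k) ≡ S⃖⁻ k a ++ S⃗⁺ k a
    blocks k = trans (map-++ proj₁ (block⁻ k) (block⁺ k)) (cong₂ _++_
      (trans (map-proj₁-block _ _ _ up) (cong (concatMap (letter (- (+ k)) (- (+ suc k)))) (sym a-rev)))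
      (trans (map-proj₁-block _ _ _ dn) (cong (concatMap (letter (+ k) (+ suc k))) (sym a≡))))
    go : ∀ k → map proj₁ (zetaWord k) ≡ zetaAux a k
    go zero = blocks 0
    go (suc k) = trans (map-++ proj₁ (block⁻ (suc k) ++ block⁺ (suc k)) (zetaWord k)) (cong₂ _++_ (blocks (suc k)) (go k))

  block⁻-all : ∀ k (P : ℕ × ℕ → Set) → (∀ j → P (j , suc (dbl k))) → All (P ∘ proj₂) (block⁻ k)
  block⁻-all k P p = block-all _ _ _ P (All.universal p up)

  block⁺-all : ∀ k (P : ℕ × ℕ → Set) → (∀ j → P (j , dbl k)) → All (P ∘ proj₂) (block⁺ k)
  block⁺-all k P p = block-all _ _ _ P (All.universal p dn)

  zetaWord-bound : ∀ k → All ((λ l → proj₂ l ℕ.< dbl (suc k)) ∘ proj₂) (zetaWord k)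
  zetaWord-bound zero = AllP.++⁺ (block⁻-all 0 _ (λ _ → ℕP.≤-refl)) (block⁺-all 0 _ (λ _ → s≤s z≤n))
  zetaWord-bound (suc k) = AllP.++⁺
    (AllP.++⁺ (block⁻-all (suc k) _ (λ _ → ℕP.≤-refl)) (block⁺-all (suc k) _ (λ _ → ℕP.n≤1+n _)))
    (All.map (λ lt → ℕP.≤-trans lt (ℕP.≤-trans (ℕP.n≤1+n _) (ℕP.n≤1+n _))) (zetaWord-bound k))

  blocks-sorted : ∀ k → Sorted _≺_ ≺-trans ≺-irrefl (block⁻ k ++ block⁺ k)
  blocks-sorted k = AllPairsP.++⁺
    (block-sorted _ _ _ (AllPairs.map (ReadBefore-odd k) (oneTo-sorted n)))
    (block-sorted _ _ _ (AllPairs.map (ReadBefore-even k) (reverse-oneTo-sorted n)))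
    (block⁻-all k (λ l → All (λ m → l ≺ proj₂ m) (block⁺ k)) (λ i → block⁺-all k ((i , suc (dbl k)) ≺_) (λ _ → inj₁ ℕP.≤-refl)))

  zetaWord-sorted : ∀ k → Sorted _≺_ ≺-trans ≺-irrefl (zetaWord k)
  zetaWord-sorted zero = blocks-sorted 0
  zetaWord-sorted (suc k) = AllPairsP.++⁺ (blocks-sorted (suc k)) (zetaWord-sorted k)
    (AllP.++⁺
      (block⁻-all (suc k) (λ l → All (λ m → l ≺ proj₂ m) (zetaWord k))
        (λ i → All.map (λ lt → inj₁ (ℕP.m≤n⇒m≤1+n lt)) (zetaWord-bound k)))
      (block⁺-all (suc k) (λ l → All (λ m → l ≺ proj₂ m) (zetaWord k))
        (λ i → All.map inj₁ (zetaWord-bound k))))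

  -- The entry k + 1 gives an N in the block of index k + 1 and an E in the one of index k of the
  -- same sign, and likewise -(k + 1); these blocks differ by 2. At entry 0 the truncated
  -- subtraction yields a meaningless key, since there is no E.
  nKey eKey : ℕ → ℕ × ℕ
  nKey j = j , level (c j)
  eKey j = j , level (c j) ∸ 2

  level-set-key : ∀ (f : ℤ → ℕ) {t} x js → t ≡ f x → map (_, t) (level-set x js) ≡ map (λ j → j , f (c j)) (level-set x js)
  level-set-key f x js refl = map-cong-local (All.map (λ c≡x → cong (λ y → _ , f y) (sym c≡x)) (AllP.all-filter (λ j → c j ℤ.≟ x) js))

  -- The labels in the order of the letters of the zeta word: windowRev lists the first n letters N
  -- (it is the reversed window) and eLabels the letters E.
  windowRev eLabels : ℕ → List ℕ
  windowRev zero = level-set (+ 1) dn ++ level-set (+ 0) up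
  windowRev (suc k) = level-set (+ suc (suc k)) dn ++ level-set (- (+ suc k)) up ++ windowRev k
  eLabels zero = level-set (- (+ 1)) up ++ level-set (+ 1) dn
  eLabels (suc k) = (level-set (- (+ suc (suc k))) up ++ level-set (+ suc (suc k)) dn) ++ eLabels k

  pickE-zetaWord : ∀ k → pick E (zetaWord k) ≡ map eKey (eLabels k)
  pickE-zetaWord k = go k
    where
    neg≢ : ∀ k → - (+ k) ≢ - (+ suc k)
    neg≢ k eq with () ← ℕP.1+n≢n (sym (ℤP.+-injective (ℤP.neg-injective eq)))
    pos≢ : ∀ k → + k ≢ + suc k
    pos≢ k eq with () ← ℕP.1+n≢n (sym (ℤP.+-injective eq))
    blocks : ∀ k → pick E (block⁻ k ++ block⁺ k) ≡ map eKey (level-set (- (+ suc k)) up ++ level-set (+ suc k) dn)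
    blocks k = trans (pick-++ E (block⁻ k) (block⁺ k)) (trans (cong₂ _++_
      (trans (pickE-block _ _ _ up (neg≢ k)) (level-set-key (λ x → level x ∸ 2) _ up refl))
      (trans (pickE-block _ _ _ dn (pos≢ k)) (level-set-key (λ x → level x ∸ 2) _ dn refl)))
      (sym (map-++ eKey (level-set (- (+ suc k)) up) _)))
    go : ∀ k → pick E (zetaWord k) ≡ map eKey (eLabels k)
    go zero = blocks 0
    go (suc k) = trans (pick-++ E (block⁻ (suc k) ++ block⁺ (suc k)) _) (trans (cong₂ _++_ (blocks (suc k)) (go k))
      (sym (map-++ eKey (level-set (- (+ suc (suc k))) up ++ level-set (+ suc (suc k)) dn) _)))

  -- `windowRev` groups the entries -k and k + 1, as a block of the window does, while the N's of
  -- `block⁻ k` and `block⁺ k` come from -k and k. The leading level set repairs this shift by one;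
  -- at `k ≡ n` it is empty.
  pickN-zetaWord : ∀ k → map nKey (level-set (+ suc k) dn) ++ pick N (zetaWord k) ≡
    map nKey (windowRev k) ++ map (_, 0) (level-set (+ 0) dn)
  pickN-zetaWord zero = begin
    A ++ pick N (block⁻ 0 ++ block⁺ 0)         ≡⟨ cong (A ++_) (pick-++ N (block⁻ 0) _) ⟩
    A ++ pick N (block⁻ 0) ++ pick N (block⁺ 0) ≡⟨ cong (A ++_) (cong₂ _++_
        (trans (pickN-block _ _ _ up) (level-set-key level (+ 0) up refl)) (pickN-block _ _ _ dn)) ⟩
    A ++ map nKey (level-set (+ 0) up) ++ Z    ≡⟨ ++-assoc A _ Z ⟨
    (A ++ map nKey (level-set (+ 0) up)) ++ Z  ≡⟨ cong (_++ Z) (map-++ nKey (level-set (+ 1) dn) _) ⟨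
    map nKey (windowRev 0) ++ Z                ∎
    where
    open ≡-Reasoning
    A = map nKey (level-set (+ 1) dn)
    Z = map (_, 0) (level-set (+ 0) dn)
  pickN-zetaWord (suc k) = begin
    A ++ pick N ((block⁻ (suc k) ++ block⁺ (suc k)) ++ zetaWord k)
      ≡⟨ cong (A ++_) (pick-++ N (block⁻ (suc k) ++ block⁺ (suc k)) _) ⟩
    A ++ pick N (block⁻ (suc k) ++ block⁺ (suc k)) ++ pick N (zetaWord k)
      ≡⟨ cong (λ x → A ++ x ++ pick N (zetaWord k)) (trans (pick-++ N (block⁻ (suc k)) _) (cong₂ _++_
          (trans (pickN-block _ _ _ up) (level-set-key level (- (+ suc k)) up refl))
          (trans (pickN-block _ _ _ dn) (level-set-key level (+ suc k) dn refl)))) ⟩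
    A ++ (B ++ C) ++ pick N (zetaWord k)    ≡⟨ cong (A ++_) (++-assoc B C _) ⟩
    A ++ B ++ C ++ pick N (zetaWord k)      ≡⟨ cong (λ x → A ++ B ++ x) (pickN-zetaWord k) ⟩
    A ++ B ++ map nKey (windowRev k) ++ Z   ≡⟨ cong (A ++_) (++-assoc B _ Z) ⟨
    A ++ (B ++ map nKey (windowRev k)) ++ Z ≡⟨ ++-assoc A _ Z ⟨
    (A ++ B ++ map nKey (windowRev k)) ++ Z
      ≡⟨ cong (_++ Z) (trans (cong (A ++_) (sym (map-++ nKey (level-set (- (+ suc k)) up) _)))
           (sym (map-++ nKey (level-set (+ suc (suc k)) dn) _))) ⟩
    map nKey (windowRev (suc k)) ++ Z       ∎
    where
    open ≡-Reasoning
    A = map nKey (level-set (+ suc (suc k)) dn)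
    B = map nKey (level-set (- (+ suc k)) up)
    C = map nKey (level-set (+ suc k) dn)
    Z = map (_, 0) (level-set (+ 0) dn)

  -- Here the shift by one concerns the negative entries, because the E's of `block⁻ k` come from
  -- -(k + 1). The indices of entry 0, having no E, are left over at the end.
  windowRev-eLabels : ∀ k → level-set (- (+ suc k)) up ++ windowRev k ≡ eLabels k ++ level-set (+ 0) up
  windowRev-eLabels zero = sym (++-assoc (level-set (- (+ 1)) up) (level-set (+ 1) dn) _)
  windowRev-eLabels (suc k) = begin
    A ++ B ++ level-set (- (+ suc k)) up ++ windowRev k ≡⟨ cong (λ x → A ++ B ++ x) (windowRev-eLabels k) ⟩
    A ++ B ++ eLabels k ++ Z                            ≡⟨ ++-assoc A B _ ⟨
    (A ++ B) ++ eLabels k ++ Z                          ≡⟨ ++-assoc (A ++ B) (eLabels k) Z ⟨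
    ((A ++ B) ++ eLabels k) ++ Z                        ∎
    where
    open ≡-Reasoning
    A = level-set (- (+ suc (suc k))) up
    B = level-set (+ suc (suc k)) dn
    Z = level-set (+ 0) up

  windowBlock : ℕ → List ℕ
  windowBlock i = level-set (- (+ i)) dn ++ level-set (+ suc i) up

  windowLabels : List ℕ
  windowLabels = concatMap windowBlock (upTo (suc n))

  reverse-level-set-dn : ∀ x → reverse (level-set x dn) ≡ level-set x up
  reverse-level-set-dn x = trans (cong reverse (filter-reverse _ up)) (reverse-involutive _)

  windowBlocks≡ : ∀ k → concatMap windowBlock (upTo (suc k)) ≡ reverse (windowRev k)
  windowBlocks≡ zero = trans (++-identityʳ _) (trans
    (cong₂ _++_ (filter-reverse _ up) (sym (reverse-level-set-dn (+ 1))))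
    (sym (reverse-++ (level-set (+ 1) dn) _)))
  windowBlocks≡ (suc k) = begin
    concatMap windowBlock (upTo (suc (suc k)))
      ≡⟨ cong (concatMap windowBlock) (upTo-∷ʳ (suc k)) ⟨
    concatMap windowBlock (upTo (suc k) ++ suc k ∷ [])
      ≡⟨ concatMap-++ windowBlock (upTo (suc k)) (suc k ∷ []) ⟩
    concatMap windowBlock (upTo (suc k)) ++ windowBlock (suc k) ++ []
      ≡⟨ cong₂ _++_ (windowBlocks≡ k) (++-identityʳ _) ⟩
    reverse (windowRev k) ++ level-set (- (+ suc k)) dn ++ level-set (+ suc (suc k)) up
      ≡⟨ cong (reverse (windowRev k) ++_) (cong₂ _++_ (filter-reverse _ up) (sym (reverse-level-set-dn _))) ⟩
    reverse (windowRev k) ++ reverse (level-set (- (+ suc k)) up) ++ reverse (level-set (+ suc (suc k)) dn)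
      ≡⟨ ++-assoc (reverse (windowRev k)) _ _ ⟨
    (reverse (windowRev k) ++ reverse (level-set (- (+ suc k)) up)) ++ reverse (level-set (+ suc (suc k)) dn)
      ≡⟨ cong (_++ reverse (level-set (+ suc (suc k)) dn)) (reverse-++ (level-set (- (+ suc k)) up) _) ⟨
    reverse (level-set (- (+ suc k)) up ++ windowRev k) ++ reverse (level-set (+ suc (suc k)) dn)
      ≡⟨ reverse-++ (level-set (+ suc (suc k)) dn) _ ⟨
    reverse (windowRev (suc k)) ∎
    where open ≡-Reasoning

-- Window positions and the letters belonging to them

[]≡⇒nthℕ : ∀ {xs k y} → xs [ k ]≡ y → nthℕ xs (suc k) ≡ y
[]≡⇒nthℕ here = refl
[]≡⇒nthℕ (there p) = []≡⇒nthℕ p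

[]≡⇒nthℤ : ∀ {xs k y} → xs [ k ]≡ y → nthℤ xs (suc k) ≡ y
[]≡⇒nthℤ here = refl
[]≡⇒nthℤ (there p) = []≡⇒nthℤ p

[]≡-map⁻ : ∀ {A B : Set} (f : A → B) xs {k y} → map f xs [ k ]≡ y → ∃[ x ] (xs [ k ]≡ x × y ≡ f x)
[]≡-map⁻ f (x ∷ xs) here = x , here , refl
[]≡-map⁻ f (x ∷ xs) (there p) with y , q , eq ← []≡-map⁻ f xs p = y , there q , eq

[]≡-reverse : ∀ {A : Set} {xs : List A} {k y} → xs [ k ]≡ y → reverse xs [ length xs ∸ suc k ]≡ y
[]≡-reverse {xs = x ∷ xs} here = subst₂ (_[_]≡ x) (sym (unfold-reverse x xs))
  (trans (ℕP.+-identityʳ _) (length-reverse xs)) ([]≡-++⁺ʳ (reverse xs) here)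
[]≡-reverse {xs = x ∷ xs} {y = y} (there p) =
  subst (_[ _ ]≡ y) (sym (unfold-reverse x xs)) ([]≡-++⁺ˡ (x ∷ []) ([]≡-reverse p))

AllPairs-++⁻ˡ : ∀ {A : Set} {R : A → A → Set} xs {ys} → AllPairs R (xs ++ ys) → AllPairs R xs
AllPairs-++⁻ˡ [] _ = []
AllPairs-++⁻ˡ (x ∷ xs) (all ∷ ap) = AllP.++⁻ˡ xs all ∷ AllPairs-++⁻ˡ xs ap

level≥1 : ∀ x → 1 ≤ level x
level≥1 (+ zero) = s≤s z≤n
level≥1 +[1+ k ] = s≤s z≤n
level≥1 -[1+ k ] = s≤s z≤n

∸2< : ∀ {m} → 1 ≤ m → m ∸ 2 ℕ.< m
∸2< {suc m} _ = s≤s (ℕP.m∸n≤m m 1)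

module _ (n : ℕ) (c : ℕ → ℤ) (bounded : ∀ {j} → InRange n j → ∣ c j ∣ ≤ n) where

  private
    up = oneTo n
    dn = reverse (oneTo n)
    word = zetaWord n c n
    rev = windowRev n c n
    E-labels = eLabels n c n
    zeros↑ = level-set n c (+ 0) up
    zeros↓ = level-set n c (+ 0) dn

  -- Used at ±(n + 1), where it removes the boundary terms of `pickN-zetaWord` and
  -- `windowRev-eLabels`.
  level-set-empty : ∀ x js → (∀ {j} → j ∈ js → InRange n j) → n ℕ.< ∣ x ∣ → level-set n c x js ≡ []
  level-set-empty x js js⊆ n<x = filter-none _ (All.tabulate λ {j} j∈ cj≡x →
    ℕP.<⇒≱ n<x (subst (λ y → ∣ y ∣ ≤ n) cj≡x (bounded (js⊆ j∈))))

  ∈-dn⁻ : ∀ {j} → j ∈ dn → InRange n j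
  ∈-dn⁻ j∈ = ∈-oneTo⁻ (AnyP.reverse⁻ j∈)

  ∈-dn⁺ : ∀ {j} → InRange n j → j ∈ dn
  ∈-dn⁺ j∈ = AnyP.reverse⁺ (∈-oneTo⁺ j∈)

  pickN-word : pick N word ≡ map (nKey n c) rev ++ map (_, 0) zeros↓
  pickN-word = subst (λ js → map (nKey n c) js ++ pick N word ≡ map (nKey n c) rev ++ map (_, 0) zeros↓)
    (level-set-empty (+ suc n) dn ∈-dn⁻ ℕP.≤-refl) (pickN-zetaWord n c n)

  rev≡ : rev ≡ E-labels ++ zeros↑
  rev≡ = subst (λ js → js ++ rev ≡ E-labels ++ zeros↑)
    (level-set-empty (- (+ suc n)) up ∈-oneTo⁻ ℕP.≤-refl) (windowRev-eLabels n c n)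

  ∈-rev⁻ : ∀ k {j} → j ∈ windowRev n c k → InRange n j
  ∈-rev⁻ zero j∈ with ∈-++⁻ (level-set n c (+ 1) dn) j∈
  ... | inj₁ j∈₁ = ∈-dn⁻ (proj₁ (∈-filter⁻ (λ j → c j ℤ.≟ + 1) {xs = dn} j∈₁))
  ... | inj₂ j∈₂ = ∈-oneTo⁻ (proj₁ (∈-filter⁻ (λ j → c j ℤ.≟ + 0) {xs = up} j∈₂))
  ∈-rev⁻ (suc k) j∈ with ∈-++⁻ (level-set n c (+ suc (suc k)) dn) j∈
  ... | inj₁ j∈₁ = ∈-dn⁻ (proj₁ (∈-filter⁻ (λ j → c j ℤ.≟ _) {xs = dn} j∈₁))
  ... | inj₂ j∈′ with ∈-++⁻ (level-set n c (- (+ suc k)) up) j∈′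
  ...   | inj₁ j∈₂ = ∈-oneTo⁻ (proj₁ (∈-filter⁻ (λ j → c j ℤ.≟ _) {xs = up} j∈₂))
  ...   | inj₂ j∈₃ = ∈-rev⁻ k j∈₃

  ∈-rev⁺ : ∀ k {j} → InRange n j → ∣ c j ∣ ≤ k → j ∈ windowRev n c k
  ∈-rev⁺ zero {j} j∈ c≤0 = ∈-++⁺ʳ (level-set n c (+ 1) dn)
    (∈-filter⁺ _ (∈-oneTo⁺ j∈) (ℤP.∣i∣≡0⇒i≡0 (ℕP.n≤0⇒n≡0 c≤0)))
  ∈-rev⁺ (suc k) {j} j∈ c≤ with ℕP.m≤n⇒m<n∨m≡n c≤
  ... | inj₁ c< = ∈-++⁺ʳ (level-set n c (+ suc (suc k)) dn) (∈-++⁺ʳ (level-set n c (- (+ suc k)) up) (∈-rev⁺ k j∈ (ℕP.≤-pred c<)))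
  ... | inj₂ c≡ with c j in eq
  -- A positive entry of maximal absolute value opens the inner `windowRev`, whose defining clause
  -- differs at zero; hence two cases.
  ∈-rev⁺ (suc zero) {j} j∈ c≤ | inj₂ refl | + .1 =
    ∈-++⁺ʳ (level-set n c (+ 2) dn) (∈-++⁺ʳ (level-set n c (- (+ 1)) up)
      (∈-++⁺ˡ {xs = level-set n c (+ 1) dn} (∈-filter⁺ _ (∈-dn⁺ j∈) eq)))
  ∈-rev⁺ (suc (suc k)) {j} j∈ c≤ | inj₂ refl | + .(suc (suc k)) =
    ∈-++⁺ʳ (level-set n c (+ suc (suc (suc k))) dn) (∈-++⁺ʳ (level-set n c (- (+ suc (suc k))) up)
      (∈-++⁺ˡ {xs = level-set n c (+ suc (suc k)) dn} (∈-filter⁺ _ (∈-dn⁺ j∈) eq)))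
  ∈-rev⁺ (suc k) {j} j∈ c≤ | inj₂ refl | -[1+ .k ] = ∈-++⁺ʳ (level-set n c (+ suc (suc k)) dn)
    (∈-++⁺ˡ {xs = level-set n c (- (+ suc k)) up} (∈-filter⁺ _ (∈-oneTo⁺ j∈) eq))

  rev-sorted : AllPairs (λ i j → nKey n c i ≺ nKey n c j) rev
  rev-sorted = AllPairsP.map⁻ (AllPairs-++⁻ˡ (map (nKey n c) rev)
    (subst (AllPairs _≺_) pickN-word (pick-sorted N (zetaWord-sorted n c n))))

  -- Strict order of the keys along `rev` excludes repetitions, so equality of the underlying sets
  -- is enough.
  rev↭oneTo : rev ↭ oneTo n
  rev↭oneTo = ∼bag⇒↭ (unique∧set⇒bag
    (AllPairs.map (λ i≺j i≡j → ≺-irrefl (subst (λ k → nKey n c k ≺ _) i≡j i≺j)) rev-sorted)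
    (AllPairs.map ℕP.<⇒≢ (oneTo-sorted n))
    (mk⇔ (∈-oneTo⁺ ∘ ∈-rev⁻ n) (λ j∈ → ∈-rev⁺ n (∈-oneTo⁻ j∈) (bounded (∈-oneTo⁻ j∈)))))

  windowLabels≡ : windowLabels n c ≡ reverse rev
  windowLabels≡ = windowBlocks≡ n c n

  windowLabels↭oneTo : windowLabels n c ↭ oneTo n
  windowLabels↭oneTo = subst (_↭ oneTo n) (sym windowLabels≡) (↭-trans (↭P.↭-reverse rev) rev↭oneTo)

  length-oneTo : length (oneTo n) ≡ n
  length-oneTo = trans (length-map suc (upTo n)) (length-upTo n)

  length-rev : length rev ≡ n
  length-rev = trans (↭P.↭-length rev↭oneTo) length-oneTo

  length-windowLabels : length (windowLabels n c) ≡ n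
  length-windowLabels = trans (↭P.↭-length windowLabels↭oneTo) length-oneTo

  zeros↓≡ : zeros↓ ≡ reverse zeros↑
  zeros↓≡ = filter-reverse (λ j → c j ℤ.≟ + 0) up

  windowLabels-zeros : windowLabels n c ≡ zeros↓ ++ reverse E-labels
  windowLabels-zeros = trans windowLabels≡ (trans (cong reverse rev≡)
    (trans (reverse-++ E-labels zeros↑) (cong (_++ reverse E-labels) (sym zeros↓≡))))

  eLabels-nonzero : ∀ k → All (λ j → c j ≢ 0ℤ) (eLabels n c k)
  eLabels-nonzero k = go k
    where
    level-set-nonzero : ∀ x js → x ≢ 0ℤ → All (λ j → c j ≢ 0ℤ) (level-set n c x js)
    level-set-nonzero x js x≢0 = All.map (λ c≡x c≡0 → x≢0 (trans (sym c≡x) c≡0)) (AllP.all-filter _ js)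
    go : ∀ k → All (λ j → c j ≢ 0ℤ) (eLabels n c k)
    go zero = AllP.++⁺ (level-set-nonzero _ up λ ()) (level-set-nonzero _ dn λ ())
    go (suc k) = AllP.++⁺ (AllP.++⁺ (level-set-nonzero _ up λ ()) (level-set-nonzero _ dn λ ())) (go k)

  label : ℕ → ℕ
  label a = nthℕ (windowLabels n c) a

  label-at : ∀ {a} → InRange n a → windowLabels n c [ a ∸ 1 ]≡ label a
  label-at {suc a} (_ , a<n)
    with y , p ← <⇒[]≡ (windowLabels n c) (subst (a ℕ.<_) (sym length-windowLabels) a<n)
    = subst (_ [ a ]≡_) (sym ([]≡⇒nthℕ p)) p

  label-range : ∀ {a} → InRange n a → InRange n (label a)
  label-range {a} a∈ = ∈-rev⁻ n (AnyP.reverse⁻ (subst (label a ∈_) windowLabels≡ ([]≡⇒∈ (label-at a∈))))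

  rev-at : ∀ {a} → InRange n a → rev [ n ∸ a ]≡ label a
  rev-at {suc a} a∈ = subst₂ (_[_]≡ label (suc a))
    (trans (cong reverse windowLabels≡) (reverse-involutive rev)) (cong (_∸ suc a) length-windowLabels)
    ([]≡-reverse (label-at a∈))

  N-at : ∀ {a} → InRange n a → pick N word [ n ∸ a ]≡ nKey n c (label a)
  N-at {a} a∈ = subst (_[ n ∸ a ]≡ nKey n c (label a)) (sym pickN-word) ([]≡-++⁺ˡ _ ([]≡-map⁺ (nKey n c) (rev-at a∈)))

  -- The window opens with the indices of entry 0 in decreasing order, and the last block reads its
  -- N's in the same order. So these positions, and no others, have a second N.
  zero-label : ∀ {a} → InRange n a →
    (c (label a) ≡ 0ℤ × zeros↓ [ a ∸ 1 ]≡ label a) ⊎ (c (label a) ≢ 0ℤ × length zeros↓ ≤ a ∸ 1)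
  zero-label {a} a∈ with []≡-++⁻ zeros↓ (subst (_[ a ∸ 1 ]≡ label a) windowLabels-zeros (label-at a∈))
  ... | inj₁ p = inj₁ (All.lookup (AllP.all-filter (λ j → c j ℤ.≟ 0ℤ) dn) ([]≡⇒∈ p) , p)
  ... | inj₂ (le , a∈E) = inj₂ (All.lookup (eLabels-nonzero n) (AnyP.reverse⁻ a∈E) , le)

  length-nKeys : length (map (nKey n c) rev) ≡ n
  length-nKeys = trans (length-map (nKey n c) rev) length-rev

  second-N-at : ∀ {a} → InRange n a → c (label a) ≡ 0ℤ → pick N word [ n ℕ.+ (a ∸ 1) ]≡ (label a , 0)
  second-N-at {a} a∈ c≡0 with zero-label a∈
  ... | inj₂ (c≢0 , _) = ⊥-elim (c≢0 c≡0)
  ... | inj₁ (_ , p) = subst₂ (_[_]≡ (label a , 0)) (sym pickN-word) (cong (ℕ._+ (a ∸ 1)) length-nKeys)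
    ([]≡-++⁺ʳ (map (nKey n c) rev) ([]≡-map⁺ (_, 0) p))

  length-pickN : length (pick N word) ≡ n ℕ.+ length zeros↓
  length-pickN = trans (cong length pickN-word) (trans (length-++ (map (nKey n c) rev))
    (cong₂ ℕ._+_ length-nKeys (length-map (_, 0) zeros↓)))

  no-second-N : ∀ {a} → InRange n a → c (label a) ≢ 0ℤ → length (pick N word) ≤ n ℕ.+ (a ∸ 1)
  no-second-N a∈ c≢0 with zero-label a∈
  ... | inj₁ (c≡0 , _) = ⊥-elim (c≢0 c≡0)
  ... | inj₂ (_ , le) = ℕP.≤-trans (ℕP.≤-reflexive length-pickN) (ℕP.+-monoʳ-≤ n le)

  length-pickE : length (pick E word) ≡ length E-labels
  length-pickE = trans (cong length (pickE-zetaWord n c n)) (length-map (eKey n c) E-labels)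

  nonzero-label : ∀ {a} → InRange n a →
    (c (label a) ≢ 0ℤ × E-labels [ n ∸ a ]≡ label a) ⊎ (c (label a) ≡ 0ℤ × length E-labels ≤ n ∸ a)
  nonzero-label {a} a∈ with []≡-++⁻ E-labels (subst (_[ n ∸ a ]≡ label a) rev≡ (rev-at a∈))
  ... | inj₁ p = inj₁ (All.lookup (eLabels-nonzero n) ([]≡⇒∈ p) , p)
  ... | inj₂ (le , a∈Z) = inj₂ (All.lookup (AllP.all-filter (λ j → c j ℤ.≟ 0ℤ) up) a∈Z , le)

  E-at : ∀ {a} → InRange n a → c (label a) ≢ 0ℤ → pick E word [ n ∸ a ]≡ eKey n c (label a)
  E-at {a} a∈ c≢0 with nonzero-label a∈
  ... | inj₁ (_ , p) = subst (_[ n ∸ a ]≡ eKey n c (label a)) (sym (pickE-zetaWord n c n)) ([]≡-map⁺ (eKey n c) p)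
  ... | inj₂ (c≡0 , _) = ⊥-elim (c≢0 c≡0)

  no-E : ∀ {a} → InRange n a → c (label a) ≡ 0ℤ → length (pick E word) ≤ n ∸ a
  no-E a∈ c≡0 with nonzero-label a∈
  ... | inj₁ (c≢0 , _) = ⊥-elim (c≢0 c≡0)
  ... | inj₂ (_ , le) = ℕP.≤-trans (ℕP.≤-reflexive length-pickE) le

  nKey≺eKey : ∀ j → nKey n c j ≺ eKey n c j
  nKey≺eKey j = inj₁ (∸2< (level≥1 (c j)))

  |E|+|Z| : length E-labels ℕ.+ length zeros↑ ≡ n
  |E|+|Z| = trans (sym (length-++ E-labels)) (trans (cong length (sym rev≡)) length-rev)

  -- `E-labels` is a prefix of `rev`, so an E and the N at the same position share an index, and the
  -- N lies in an earlier block. Each index of entry 0 trades its E for a second N, which makes the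
  -- length 2 n.
  valley∈Cell : ∀ {v} → v ∈ valleys (map proj₁ word) → Cell n v
  valley∈Cell = valley-cell _≺_ ≺-trans ≺-irrefl (zetaWord-sorted n c n) |E|≤n |word|≤2n ballot
    where
    |E|≤n : length (pick E word) ≤ n
    |E|≤n = ℕP.≤-trans (ℕP.≤-reflexive length-pickE)
      (ℕP.≤-trans (ℕP.m≤m+n _ (length zeros↑)) (ℕP.≤-reflexive |E|+|Z|))
    |word|≤2n : length (pick E word) ℕ.+ length (pick N word) ≤ n ℕ.+ n
    |word|≤2n = ℕP.≤-reflexive (begin
      length (pick E word) ℕ.+ length (pick N word)     ≡⟨ cong₂ ℕ._+_ length-pickE length-pickN ⟩
      length E-labels ℕ.+ (n ℕ.+ length zeros↓)         ≡⟨ cong (λ m → length E-labels ℕ.+ (n ℕ.+ m)) (trans (cong length zeros↓≡) (length-reverse zeros↑)) ⟩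
      length E-labels ℕ.+ (n ℕ.+ length zeros↑)         ≡⟨ cong (length E-labels ℕ.+_) (ℕP.+-comm n _) ⟩
      length E-labels ℕ.+ (length zeros↑ ℕ.+ n)         ≡⟨ ℕP.+-assoc (length E-labels) _ n ⟨
      length E-labels ℕ.+ length zeros↑ ℕ.+ n           ≡⟨ cong (ℕ._+ n) |E|+|Z| ⟩
      n ℕ.+ n                                           ∎)
      where open ≡-Reasoning
    ballot : ∀ {i l} → pick E word [ i ]≡ l → ∃[ m ] (pick N word [ i ]≡ m × m ≺ l)
    ballot {i} {l} p with j , q , refl ← []≡-map⁻ (eKey n c) E-labels (subst (_[ i ]≡ l) (pickE-zetaWord n c n) p) =
      nKey n c j ,
      subst (_[ i ]≡ nKey n c j) (sym pickN-word)
        ([]≡-++⁺ˡ _ ([]≡-map⁺ (nKey n c) (subst (_[ i ]≡ j) (sym rev≡) ([]≡-++⁺ˡ zeros↑ q)))) ,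
      nKey≺eKey j

  -- Membership in I from the order of two letters

  Below : ℕ → ℕ → Set
  Below = ValleyBelow _≺_ ≺-trans ≺-irrefl (zetaWord-sorted n c n)

  -- `alpha-cancel` turns a valley root below `x` into a valley nested under the cell of `x`; it
  -- applies because every valley is a cell.
  ¬Below⇒InI : ∀ {i j x} → Cell n (suc i , suc j) → alpha n (suc i , suc j) ≡ x → x ∈ posRoots n →
    ¬ Below i j → InI n (map proj₁ word) x
  ¬Below⇒InI cell refl x∈ ¬below =
    x∈ , λ (v , v∈ , v≤x) → ¬below (v , v∈ , alpha-cancel (valley∈Cell v∈) cell v≤x)

  Below⇒¬InI : ∀ {i j x} → Cell n (suc i , suc j) → alpha n (suc i , suc j) ≡ x →
    Below i j → ¬ InI n (map proj₁ word) x
  Below⇒¬InI cell refl (v , v∈ , v≤) (_ , noValley) = noValley (v , v∈ , alpha-mono (valley∈Cell v∈) cell v≤)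

  module _ {a b : ℕ} (1≤a : 1 ≤ a) (b≤n : b ≤ n) where

    private
      p = label a
      q = label b

    module _ (a<b : a ℕ.< b) where

      private
        a∈ = proj₁ (range-< 1≤a a<b b≤n)
        b∈ = proj₂ (range-< 1≤a a<b b≤n)

      label-order : nKey n c q ≺ nKey n c p
      label-order = []≡-AllPairs N-sorted (N-at b∈) (N-at a∈) (ℕP.∸-monoʳ-< a<b b≤n)
        where
        N-sorted : AllPairs _≺_ (pick N word)
        N-sorted = pick-sorted N (zetaWord-sorted n c n)

      private
        suc∸ : ∀ {k} → k ≤ n → suc n ∸ k ≡ suc (n ∸ k)
        suc∸ = ℕP.+-∸-assoc 1
        a≤n = proj₂ a∈
        cell : Cell n (suc (n ∸ b) , suc (n ∸ a))
        cell = s≤s z≤n , ℕP.∸-monoʳ-< (proj₁ b∈) b≤n , s≤s (ℕP.∸-monoʳ-< a<b b≤n) ,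
          s≤s (ℕP.+-mono-≤ (ℕP.m∸n≤m n b) (ℕP.∸-monoʳ-< 1≤a a≤n))
        alpha≡ : alpha n (suc (n ∸ b) , suc (n ∸ a)) ≡ e n b ⊖ e n a
        alpha≡ = trans (cong (alpha n) (cong₂ _,_ (sym (suc∸ b≤n)) (sym (suc∸ a≤n)))) (alpha-diff 1≤a a<b b≤n)

      diff∈I : c q ≡ 0ℤ ⊎ nKey n c p ≺ eKey n c q → InI n (map proj₁ word) (e n b ⊖ e n a)
      diff∈I before = ¬Below⇒InI cell alpha≡ (diff∈posRoots 1≤a a<b b≤n)
        (noValleyBelow _≺_ ≺-trans ≺-irrefl (zetaWord-sorted n c n) (N-at a∈) (noE before))
        where
        noE : c q ≡ 0ℤ ⊎ nKey n c p ≺ eKey n c q →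
          length (pick E word) ≤ n ∸ b ⊎ (∃[ l ] (pick E word [ n ∸ b ]≡ l × nKey n c p ≺ l))
        noE (inj₁ c≡0) = inj₁ (no-E b∈ c≡0)
        -- For `c q ≡ 0ℤ` the key of the E carries no information, but then this E does not exist
        -- and the other alternative holds.
        noE (inj₂ p≺q) with c q ℤ.≟ 0ℤ
        ... | yes c≡0 = inj₁ (no-E b∈ c≡0)
        ... | no c≢0 = inj₂ (_ , E-at b∈ c≢0 , p≺q)

      diff∉I : c q ≢ 0ℤ → eKey n c q ≺ nKey n c p → ¬ InI n (map proj₁ word) (e n b ⊖ e n a)
      diff∉I c≢0 q≺p = Below⇒¬InI cell alpha≡
        (valleyBelow _≺_ ≺-trans ≺-irrefl (zetaWord-sorted n c n) (E-at b∈ c≢0) (inj₂ (_ , N-at a∈ , q≺p)))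

    module _ (a≤b : a ≤ b) where

      private
        a∈ = proj₁ (range-≤ 1≤a a≤b b≤n)
        b∈ = proj₂ (range-≤ 1≤a a≤b b≤n)
        a≡ : suc (a ∸ 1) ≡ a
        a≡ = ℕP.m+[n∸m]≡n 1≤a
        n+a≡ : suc (n ℕ.+ (a ∸ 1)) ≡ n ℕ.+ a
        n+a≡ = trans (sym (ℕP.+-suc n (a ∸ 1))) (cong (n ℕ.+_) a≡)
        cell : Cell n (suc (n ∸ b) , suc (n ℕ.+ (a ∸ 1)))
        cell = s≤s z≤n , ℕP.∸-monoʳ-< (proj₁ b∈) b≤n ,
          s≤s (ℕP.<-≤-trans (ℕP.∸-monoʳ-< (proj₁ b∈) b≤n) (ℕP.m≤m+n n _)) ,
          s≤s (ℕP.≤-trans (ℕP.≤-reflexive (trans (cong (n ∸ b ℕ.+_) n+a≡) (ℕP.+-comm (n ∸ b) _)))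
            (ℕP.≤-trans (ℕP.≤-reflexive (ℕP.+-assoc n a (n ∸ b)))
              (ℕP.+-monoʳ-≤ n (ℕP.≤-trans (ℕP.+-monoˡ-≤ (n ∸ b) a≤b) (ℕP.≤-reflexive (ℕP.m+[n∸m]≡n b≤n))))))
        alpha≡ : alpha n (suc (n ∸ b) , suc (n ℕ.+ (a ∸ 1))) ≡ e n a ⊕ e n b
        alpha≡ = trans (cong (alpha n) (cong₂ _,_ (sym (ℕP.+-∸-assoc 1 b≤n)) n+a≡))
          (trans (alpha-summ 1≤a b≤n) (⊕-comm (e n b) (e n a)))

      sum∈I : c p ≡ 0ℤ → c q ≡ 0ℤ ⊎ (p , 0) ≺ eKey n c q → InI n (map proj₁ word) (e n a ⊕ e n b)
      sum∈I cp≡0 before = ¬Below⇒InI cell alpha≡ (sum∈posRoots′ a∈ b∈)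
        (noValleyBelow _≺_ ≺-trans ≺-irrefl (zetaWord-sorted n c n) (second-N-at a∈ cp≡0) (noE before))
        where
        noE : c q ≡ 0ℤ ⊎ (p , 0) ≺ eKey n c q →
          length (pick E word) ≤ n ∸ b ⊎ (∃[ l ] (pick E word [ n ∸ b ]≡ l × (p , 0) ≺ l))
        noE (inj₁ c≡0) = inj₁ (no-E b∈ c≡0)
        noE (inj₂ p≺q) with c q ℤ.≟ 0ℤ
        ... | yes c≡0 = inj₁ (no-E b∈ c≡0)
        ... | no c≢0 = inj₂ (_ , E-at b∈ c≢0 , p≺q)

      sum∉I : c q ≢ 0ℤ → c p ≢ 0ℤ ⊎ eKey n c q ≺ (p , 0) → ¬ InI n (map proj₁ word) (e n a ⊕ e n b)
      sum∉I cq≢0 after = Below⇒¬InI cell alpha≡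
        (valleyBelow _≺_ ≺-trans ≺-irrefl (zetaWord-sorted n c n) (E-at b∈ cq≢0) (noN after))
        where
        noN : c p ≢ 0ℤ ⊎ eKey n c q ≺ (p , 0) →
          length (pick N word) ≤ n ℕ.+ (a ∸ 1) ⊎ (∃[ m ] (pick N word [ n ℕ.+ (a ∸ 1) ]≡ m × eKey n c q ≺ m))
        noN (inj₁ c≢0) = inj₁ (no-second-N a∈ c≢0)
        noN (inj₂ q≺p) with c p ℤ.≟ 0ℤ
        ... | yes c≡0 = inj₂ (_ , second-N-at a∈ c≡0 , q≺p)
        ... | no c≢0 = inj₁ (no-second-N a∈ c≢0)

-- Entries in neighbouring blocks

ReadBefore-even⁻ : ∀ k {i j} → ReadBefore (dbl k) i j → j ℕ.< i
ReadBefore-even⁻ zero r = r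
ReadBefore-even⁻ (suc k) r = ReadBefore-even⁻ k r

ReadBefore-odd⁻ : ∀ k {i j} → ReadBefore (suc (dbl k)) i j → i ℕ.< j
ReadBefore-odd⁻ zero r = r
ReadBefore-odd⁻ (suc k) r = ReadBefore-odd⁻ k r

dbl-injective : ∀ k l → dbl k ≡ dbl l → k ≡ l
dbl-injective zero zero _ = refl
dbl-injective (suc k) (suc l) eq = cong suc (dbl-injective k l (ℕP.suc-injective (ℕP.suc-injective eq)))

dbl≢suc-dbl : ∀ k l → dbl k ≢ suc (dbl l)
dbl≢suc-dbl (suc k) (suc l) eq = dbl≢suc-dbl k l (ℕP.suc-injective (ℕP.suc-injective eq))

-- `level` numbers 0, 1, -1, 2, -2, ... from one upwards, so an entry and a block distance determine
-- the other entry.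
level-injective : ∀ x y → level x ≡ level y → x ≡ y
level-injective (+ zero) (+ zero) _ = refl
level-injective (+ zero) +[1+ l ] eq = ⊥-elim (dbl≢suc-dbl (suc l) 0 (sym eq))
level-injective +[1+ k ] (+ zero) eq = ⊥-elim (dbl≢suc-dbl (suc k) 0 eq)
level-injective +[1+ k ] +[1+ l ] eq = cong +_ (dbl-injective (suc k) (suc l) eq)
level-injective +[1+ k ] -[1+ l ] eq = ⊥-elim (dbl≢suc-dbl (suc k) (suc l) eq)
level-injective -[1+ k ] +[1+ l ] eq = ⊥-elim (dbl≢suc-dbl (suc l) (suc k) (sym eq))
level-injective -[1+ k ] -[1+ l ] eq =
  cong -[1+_] (ℕP.suc-injective (dbl-injective (suc k) (suc l) (ℕP.suc-injective eq)))

-- The possible entries x , y at positions p , q such that the letter N of q precedes the one of p.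
data Config (p q : ℕ) : ℤ → ℤ → Set where
  same⁺ : ∀ k → p ℕ.< q → Config p q +[1+ k ] +[1+ k ]
  same⁻ : ∀ k → q ℕ.< p → Config p q -[1+ k ] -[1+ k ]
  same⁰ : q ℕ.< p → Config p q 0ℤ 0ℤ
  opp⁺  : ∀ k → Config p q +[1+ k ] -[1+ k ]
  opp⁻  : ∀ k → Config p q -[1+ k ] +[1+ suc k ]
  opp⁰  : Config p q 0ℤ 1ℤ
  next⁺ : ∀ k → Config p q +[1+ k ] +[1+ suc k ]
  next⁻ : ∀ k → Config p q -[1+ k ] -[1+ suc k ]
  next⁰ : Config p q 0ℤ (- 1ℤ)
  far   : ∀ {x y} → suc (suc (level x)) ℕ.< level y → Config p q x y

level-cases : ∀ {m l} → m ≤ l → l ≤ suc (suc m) → l ≡ m ⊎ l ≡ suc m ⊎ l ≡ suc (suc m)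
level-cases m≤l l≤2+m with ℕP.m≤n⇒m<n∨m≡n m≤l
... | inj₂ m≡l = inj₁ (sym m≡l)
... | inj₁ m<l with ℕP.m≤n⇒m<n∨m≡n m<l
...   | inj₂ 1+m≡l = inj₂ (inj₁ (sym 1+m≡l))
...   | inj₁ 1+m<l = inj₂ (inj₂ (ℕP.≤-antisym l≤2+m 1+m<l))

-- At distance at most two, `level-injective` leaves a single `y` for each `x`. Only at distance
-- zero does the hypothesis also order the indices, by the reading direction of the common block.
config : ∀ p q x y → (q , level y) ≺ (p , level x) → Config p q x y
config p q x y q≺p with suc (suc (level x)) ℕ.<? level y
... | yes lt = far lt
... | no ≮ = near x (level-cases (x≤y q≺p) (ℕP.≮⇒≥ ≮)) (order q≺p)
  where
  x≤y : (q , level y) ≺ (p , level x) → level x ≤ level y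
  x≤y (inj₁ lt) = ℕP.<⇒≤ lt
  x≤y (inj₂ (eq , _)) = ℕP.≤-reflexive (sym eq)
  order : (q , level y) ≺ (p , level x) → level y ≡ level x → ReadBefore (level x) q p
  order (inj₁ lt) eq = ⊥-elim (ℕP.<-irrefl (sym eq) lt)
  order (inj₂ (_ , r)) _ = r
  near : ∀ x → level y ≡ level x ⊎ level y ≡ suc (level x) ⊎ level y ≡ suc (suc (level x)) →
    (level y ≡ level x → ReadBefore (level x) q p) → Config p q x y
  near x (inj₁ eq) r with level-injective y x eq
  near (+ zero) (inj₁ eq) r | refl = same⁰ (r refl)
  near +[1+ k ] (inj₁ eq) r | refl = same⁺ k (ReadBefore-even⁻ k (r refl))
  near -[1+ k ] (inj₁ eq) r | refl = same⁻ k (ReadBefore-odd⁻ k (r refl))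
  near (+ zero) (inj₂ (inj₁ eq)) _ with refl ← level-injective y 1ℤ eq = opp⁰
  near +[1+ k ] (inj₂ (inj₁ eq)) _ with refl ← level-injective y -[1+ k ] eq = opp⁺ k
  near -[1+ k ] (inj₂ (inj₁ eq)) _ with refl ← level-injective y +[1+ suc k ] eq = opp⁻ k
  near (+ zero) (inj₂ (inj₂ eq)) _ with refl ← level-injective y (- 1ℤ) eq = next⁰
  near +[1+ k ] (inj₂ (inj₂ eq)) _ with refl ← level-injective y +[1+ suc k ] eq = next⁺ k
  near -[1+ k ] (inj₂ (inj₂ eq)) _ with refl ← level-injective y -[1+ suc k ] eq = next⁻ k

+[1+]+1 : ∀ k → +[1+ k ] ℤ.+ 1ℤ ≡ +[1+ suc k ]
+[1+]+1 k = cong +[1+_] (ℕP.+-comm k 1)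

-[1+]+1 : ∀ k → -[1+ k ] ℤ.+ 1ℤ ≡ - (+ k)
-[1+]+1 zero = refl
-[1+]+1 (suc k) = refl

level-neg : ∀ k → level (- (+ k)) ≡ suc (dbl k)
level-neg zero = refl
level-neg (suc k) = refl

-- Pairs contributing to dinv lie in neighbouring blocks.

level-suc : ∀ x → level (x ℤ.+ 1ℤ) ≤ suc (suc (level x)) × level x ≤ suc (suc (level (x ℤ.+ 1ℤ)))
level-suc (+ zero) = s≤s (s≤s z≤n) , s≤s z≤n
level-suc +[1+ k ] rewrite ℕP.+-comm k 1 = ℕP.≤-refl , ℕP.m≤n⇒m≤1+n (ℕP.m≤n⇒m≤1+n (ℕP.m≤n⇒m≤1+n (ℕP.m≤n⇒m≤1+n ℕP.≤-refl)))
level-suc -[1+ zero ] = s≤s z≤n , s≤s (s≤s (s≤s z≤n))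
level-suc -[1+ suc k ] = ℕP.m≤n⇒m≤1+n (ℕP.m≤n⇒m≤1+n (ℕP.m≤n⇒m≤1+n (ℕP.m≤n⇒m≤1+n ℕP.≤-refl))) , ℕP.≤-refl

level-neg≤ : ∀ x → level (- x) ≤ suc (suc (level x))
level-neg≤ (+ zero) = s≤s z≤n
level-neg≤ +[1+ k ] = ℕP.m≤n⇒m≤1+n ℕP.≤-refl
level-neg≤ -[1+ k ] = ℕP.m≤n⇒m≤1+n (ℕP.m≤n⇒m≤1+n (ℕP.m≤n⇒m≤1+n ℕP.≤-refl))

level-neg+1≤ : ∀ x → level (- x ℤ.+ 1ℤ) ≤ suc (suc (level x))
level-neg+1≤ (+ zero) = s≤s (s≤s z≤n)
level-neg+1≤ +[1+ k ] rewrite -[1+]+1 k | level-neg k = s≤s (ℕP.m≤n⇒m≤1+n (ℕP.m≤n⇒m≤1+n (ℕP.m≤n⇒m≤1+n ℕP.≤-refl)))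
level-neg+1≤ -[1+ k ] rewrite ℕP.+-comm k 1 = ℕP.m≤n⇒m≤1+n ℕP.≤-refl

-- The contribution of one pair of indices

bit : Bool → ℕ
bit b = if b then 1 else 0

pairDinv : (x y s t : ℤ) → ℕ
pairDinv x y s t =
  bit (does (x ℤ.≟ y) ∧ does (s ℤ.<? t)) ℕ.+
  bit (does (x ℤ.≟ y ℤ.+ + 1) ∧ does (t ℤ.<? s)) ℕ.+
  bit (does (x ℤ.≟ - y) ∧ does (s ℤ.<? - t)) ℕ.+
  bit (does (x ℤ.≟ - y ℤ.+ + 1) ∧ does (- t ℤ.<? s))

-- Window positions a < b may carry indices in either order, while dinv′ wants the smaller index
-- first.
unorderedDinv : (p q : ℕ) (x y s t : ℤ) → ℕ
unorderedDinv p q x y s t = if does (p ℕ.<? q) then pairDinv x y s t else pairDinv y x t s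

-- Separates the comparisons of entries, settled by each configuration, from those of the values `s`
-- and `t`, which stay symbolic.
pairDinv-eval : ∀ x y s t {e₁ e₂ e₃ e₄} → does (x ℤ.≟ y) ≡ e₁ → does (x ℤ.≟ y ℤ.+ + 1) ≡ e₂ →
  does (x ℤ.≟ - y) ≡ e₃ → does (x ℤ.≟ - y ℤ.+ + 1) ≡ e₄ →
  pairDinv x y s t ≡ bit (e₁ ∧ does (s ℤ.<? t)) ℕ.+ bit (e₂ ∧ does (t ℤ.<? s)) ℕ.+
    bit (e₃ ∧ does (s ℤ.<? - t)) ℕ.+ bit (e₄ ∧ does (- t ℤ.<? s))
pairDinv-eval _ _ _ _ refl refl refl refl = refl

-- The sign with which the window records a value: changed for entries -i, including 0, and kept for
-- entries i + 1.
signed : ℤ → ℤ → ℤ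
signed +[1+ _ ] s = s
signed _ s = - s

<?-neg : ∀ s t → does (- s ℤ.<? - t) ≡ does (t ℤ.<? s)
<?-neg s t = does-⇔ (mk⇔ ℤP.neg-cancel-< ℤP.neg-mono-<) (- s ℤ.<? - t) (t ℤ.<? s)

<?-negˡ : ∀ s t → does (- s ℤ.<? t) ≡ does (- t ℤ.<? s)
<?-negˡ s t = trans (cong (λ r → does (- s ℤ.<? r)) (sym (ℤP.neg-involutive t))) (<?-neg s (- t))

<?-negʳ : ∀ s t → does (s ℤ.<? - t) ≡ does (t ℤ.<? - s)
<?-negʳ s t = trans (cong (λ r → does (r ℤ.<? - t)) (sym (ℤP.neg-involutive s))) (<?-neg (- s) t)

x≢x+1 : ∀ x → x ≢ x ℤ.+ 1ℤ
x≢x+1 x eq = ℤP.i≢suc[i] (trans eq (ℤP.+-comm x 1ℤ))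

+[1+]≢-[1+]+1 : ∀ m k → does (+[1+ m ] ℤ.≟ -[1+ k ] ℤ.+ 1ℤ) ≡ false
+[1+]≢-[1+]+1 m zero = refl
+[1+]≢-[1+]+1 m (suc k) = refl

≡ᵇ-refl : ∀ k → does (k ℕ.≟ k) ≡ true
≡ᵇ-refl k = dec-true (k ℕ.≟ k) refl

≡ᵇ-suc : ∀ k → does (k ℕ.≟ suc k) ≡ false
≡ᵇ-suc k = dec-false (k ℕ.≟ suc k) (ℕP.1+n≢n ∘ sym)

suc-≡ᵇ : ∀ k → does (suc k ℕ.≟ k) ≡ false
suc-≡ᵇ k = dec-false (suc k ℕ.≟ k) ℕP.1+n≢n

≟+1 : ∀ x → does (x ℤ.≟ x ℤ.+ 1ℤ) ≡ false
≟+1 x = dec-false (x ℤ.≟ x ℤ.+ 1ℤ) (x≢x+1 x)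

+[1+suc]≟+[1+]+1 : ∀ k → does (+[1+ suc k ] ℤ.≟ +[1+ k ] ℤ.+ 1ℤ) ≡ true
+[1+suc]≟+[1+]+1 k = dec-true (+[1+ suc k ] ℤ.≟ +[1+ k ] ℤ.+ 1ℤ) (sym (+[1+]+1 k))

+[1+]≟+[1+suc]+1 : ∀ k → does (+[1+ k ] ℤ.≟ +[1+ suc k ] ℤ.+ 1ℤ) ≡ false
+[1+]≟+[1+suc]+1 k = trans (cong (λ y → does (+[1+ k ] ℤ.≟ y)) (+[1+]+1 (suc k)))
  (dec-false (k ℕ.≟ suc (suc k)) (ℕP.m≢1+n+m k {1}))

-[1+suc]≟-[1+]+1 : ∀ k → does (-[1+ suc k ] ℤ.≟ -[1+ k ] ℤ.+ 1ℤ) ≡ false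
-[1+suc]≟-[1+]+1 zero = refl
-[1+suc]≟-[1+]+1 (suc k) = dec-false (suc (suc k) ℕ.≟ k) (ℕP.m≢1+n+m k {1} ∘ sym)

-- Each of the four equations would bound `level y` by `level x` plus two; where `y` occurs negated,
-- the equation is first solved for `y`.
far-pairDinv : ∀ x y s t → suc (suc (level x)) ℕ.< level y → pairDinv x y s t ≡ 0 × pairDinv y x t s ≡ 0
far-pairDinv x y s t lt =
  pairDinv-eval x y s t
    (dec-false (x ℤ.≟ y) (λ eq → not (subst (λ z → level y ≤ suc (suc (level z))) (sym eq) (ℕP.m≤n⇒m≤1+n (ℕP.m≤n⇒m≤1+n ℕP.≤-refl)))))
    (dec-false (x ℤ.≟ y ℤ.+ + 1) (λ eq → not (subst (λ z → level y ≤ suc (suc (level z))) (sym eq) (proj₂ (level-suc y)))))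
    (dec-false (x ℤ.≟ - y) (λ eq → not (subst (λ z → level z ≤ suc (suc (level x))) (trans (cong -_ eq) (ℤP.neg-involutive y)) (level-neg≤ x))))
    (dec-false (x ℤ.≟ - y ℤ.+ + 1) (λ eq → not (subst (λ z → level z ≤ suc (suc (level x))) (flip-neg+1 x y eq) (level-neg+1≤ x)))) ,
  pairDinv-eval y x t s
    (dec-false (y ℤ.≟ x) (λ eq → not (subst (λ z → level z ≤ suc (suc (level x))) (sym eq) (ℕP.m≤n⇒m≤1+n (ℕP.m≤n⇒m≤1+n ℕP.≤-refl)))))
    (dec-false (y ℤ.≟ x ℤ.+ + 1) (λ eq → not (subst (λ z → level z ≤ suc (suc (level x))) (sym eq) (proj₁ (level-suc x)))))
    (dec-false (y ℤ.≟ - x) (λ eq → not (subst (λ z → level z ≤ suc (suc (level x))) (sym eq) (level-neg≤ x))))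
    (dec-false (y ℤ.≟ - x ℤ.+ + 1) (λ eq → not (subst (λ z → level z ≤ suc (suc (level x))) (sym eq) (level-neg+1≤ x))))
  where
  not : ¬ level y ≤ suc (suc (level x))
  not = ℕP.<⇒≱ lt
  flip-neg+1 : ∀ x y → x ≡ - y ℤ.+ 1ℤ → - x ℤ.+ 1ℤ ≡ y
  flip-neg+1 _ y refl = cancel y
    where
    cancel : ∀ y → - (- y ℤ.+ 1ℤ) ℤ.+ 1ℤ ≡ y
    cancel = solve-∀

module _ {A B : Set} (p q : ℕ) (x y s t : ℤ) where

  RootPairCount : Set
  RootPairCount = ∃[ i ] ∃[ j ] (Reflects A i × Reflects B j ×
    bit (i ∧ does (signed x s ℤ.<? signed y t)) ℕ.+ bit (j ∧ does (- signed y t ℤ.<? signed x s)) ≡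
    unorderedDinv p q x y s t)

module _ (p q : ℕ) (x y s t : ℤ) where

  unorderedDinv-< : p ℕ.< q → unorderedDinv p q x y s t ≡ pairDinv x y s t
  unorderedDinv-< p<q = cong (if_then pairDinv x y s t else pairDinv y x t s) (dec-true (p ℕ.<? q) p<q)

  unorderedDinv-> : q ℕ.< p → unorderedDinv p q x y s t ≡ pairDinv y x t s
  unorderedDinv-> q<p = cong (if_then pairDinv x y s t else pairDinv y x t s) (dec-false (p ℕ.<? q) (ℕP.<-asym q<p))

module _ {A B : Set} (p q : ℕ) where

  -- `A` asks whether the first N of `p` precedes the E of `q`, in block `level y ∸ 2`. At distance
  -- 0 or 1 it does (or there is no such E); at distance 2 the letters share a block and its reading
  -- direction decides; beyond that it does not. `B` asks the same of the second N of `p`, in block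
  -- 0, which requires `x ≡ 0ℤ`.
  rootPairCount : ∀ {x y} s t → Config p q x y → p ℕ.< q ⊎ q ℕ.< p →
    (y ≡ 0ℤ ⊎ (p , level x) ≺ (q , level y ∸ 2) → A) →
    (y ≢ 0ℤ → (q , level y ∸ 2) ≺ (p , level x) → ¬ A) →
    (x ≡ 0ℤ → y ≡ 0ℤ ⊎ (p , 0) ≺ (q , level y ∸ 2) → B) →
    (y ≢ 0ℤ → x ≢ 0ℤ ⊎ (q , level y ∸ 2) ≺ (p , 0) → ¬ B) →
    RootPairCount p q x y s t
  rootPairCount s t (same⁺ k p<q) _ a⁺ a⁻ b⁺ b⁻ =
    true , false , ofʸ (a⁺ (inj₂ (inj₁ (ℕP.n≤1+n _)))) , ofⁿ (b⁻ (λ ()) (inj₁ λ ())) ,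
    sym (trans (unorderedDinv-< p q +[1+ k ] +[1+ k ] s t p<q)
      (trans (pairDinv-eval +[1+ k ] +[1+ k ] s t (≡ᵇ-refl k) (≟+1 +[1+ k ]) refl (+[1+]≢-[1+]+1 k k))
        (trans (ℕP.+-identityʳ _) (ℕP.+-identityʳ _))))
  rootPairCount s t (same⁻ k q<p) _ a⁺ a⁻ b⁺ b⁻ =
    true , false , ofʸ (a⁺ (inj₂ (inj₁ (ℕP.n≤1+n _)))) , ofⁿ (b⁻ (λ ()) (inj₁ λ ())) ,
    trans (cong (λ b → bit b ℕ.+ 0) (<?-neg s t))
    (sym (trans (unorderedDinv-> p q -[1+ k ] -[1+ k ] s t q<p)
      (trans (pairDinv-eval -[1+ k ] -[1+ k ] t s (≡ᵇ-refl k) (≟+1 -[1+ k ]) refl refl)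
        (trans (ℕP.+-identityʳ _) (ℕP.+-identityʳ _)))))
  -- Both 0 ≡ 0 and 0 ≡ -0 count in dinv′, matching the two roots.
  rootPairCount s t (same⁰ q<p) _ a⁺ a⁻ b⁺ b⁻ =
    true , true , ofʸ (a⁺ (inj₁ refl)) , ofʸ (b⁺ refl (inj₁ refl)) ,
    trans (cong₂ (λ b d → bit b ℕ.+ bit d) (<?-neg s t) (cong (λ r → does (r ℤ.<? - s)) (ℤP.neg-involutive t)))
    (sym (trans (unorderedDinv-> p q 0ℤ 0ℤ s t q<p)
      (trans (ℕP.+-identityʳ _) (cong (ℕ._+ bit (does (t ℤ.<? - s))) (ℕP.+-identityʳ (bit (does (t ℤ.<? s))))))))
  -- The equation x ≡ -y is symmetric, so either order of the indices gives the same summand; the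
  -- same holds for x ≡ -y + 1 in `opp⁻`.
  rootPairCount s t (opp⁺ k) p≶q a⁺ a⁻ b⁺ b⁻ =
    true , false , ofʸ (a⁺ (inj₂ (inj₁ ℕP.≤-refl))) , ofⁿ (b⁻ (λ ()) (inj₁ λ ())) , sym (value p≶q)
    where
    value : p ℕ.< q ⊎ q ℕ.< p → unorderedDinv p q +[1+ k ] -[1+ k ] s t ≡ bit (does (s ℤ.<? - t)) ℕ.+ 0
    value (inj₁ p<q) = trans (unorderedDinv-< p q +[1+ k ] -[1+ k ] s t p<q)
      (pairDinv-eval +[1+ k ] -[1+ k ] s t refl (+[1+]≢-[1+]+1 k k) (≡ᵇ-refl k) (≟+1 +[1+ k ]))
    value (inj₂ q<p) = trans (unorderedDinv-> p q +[1+ k ] -[1+ k ] s t q<p)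
      (trans (pairDinv-eval -[1+ k ] +[1+ k ] t s refl refl (≡ᵇ-refl k) (≟+1 -[1+ k ])) (cong (λ b → bit b ℕ.+ 0) (<?-negʳ t s)))
  rootPairCount s t (opp⁻ k) p≶q a⁺ a⁻ b⁺ b⁻ =
    true , false , ofʸ (a⁺ (inj₂ (inj₁ ℕP.≤-refl))) , ofⁿ (b⁻ (λ ()) (inj₁ λ ())) ,
    trans (ℕP.+-identityʳ _) (sym (value p≶q))
    where
    value : p ℕ.< q ⊎ q ℕ.< p → unorderedDinv p q -[1+ k ] +[1+ suc k ] s t ≡ bit (does (- s ℤ.<? t))
    value (inj₁ p<q) = trans (unorderedDinv-< p q -[1+ k ] +[1+ suc k ] s t p<q)
      (trans (pairDinv-eval -[1+ k ] +[1+ suc k ] s t refl refl (≡ᵇ-suc k) (≡ᵇ-refl k)) (cong bit (<?-negˡ t s)))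
    value (inj₂ q<p) = trans (unorderedDinv-> p q -[1+ k ] +[1+ suc k ] s t q<p)
      (pairDinv-eval +[1+ suc k ] -[1+ k ] t s refl (+[1+]≢-[1+]+1 (suc k) k) (suc-≡ᵇ k) (+[1+suc]≟+[1+]+1 k))
  -- The E of `q` shares block 0 with the second N of `p`, and block 0 is read by decreasing index.
  -- So the sum root enters I only for `q < p`, which is also when 1 ≡ 0 + 1 counts as the second
  -- equation.
  rootPairCount s t opp⁰ (inj₁ p<q) a⁺ a⁻ b⁺ b⁻ =
    true , false , ofʸ (a⁺ (inj₂ (inj₁ ℕP.≤-refl))) , ofⁿ (b⁻ (λ ()) (inj₂ (inj₂ (refl , p<q)))) ,
    trans (ℕP.+-identityʳ _) (sym (trans (unorderedDinv-< p q 0ℤ 1ℤ s t p<q) (cong bit (<?-negˡ t s))))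
  rootPairCount s t opp⁰ (inj₂ q<p) a⁺ a⁻ b⁺ b⁻ =
    true , true , ofʸ (a⁺ (inj₂ (inj₁ ℕP.≤-refl))) , ofʸ (b⁺ refl (inj₂ (inj₂ (refl , q<p)))) ,
    trans (cong (λ b → bit (does (- s ℤ.<? t)) ℕ.+ bit b) (<?-neg t s))
    (sym (trans (unorderedDinv-> p q 0ℤ 1ℤ s t q<p)
      (trans (cong (ℕ._+ bit (does (- s ℤ.<? t))) (ℕP.+-identityʳ (bit (does (s ℤ.<? t))))) (ℕP.+-comm _ (bit (does (- s ℤ.<? t)))))))
  rootPairCount s t (next⁺ k) (inj₁ p<q) a⁺ a⁻ b⁺ b⁻ =
    false , false , ofⁿ (a⁻ (λ ()) (inj₂ (refl , ReadBefore-even (suc k) p<q))) , ofⁿ (b⁻ (λ ()) (inj₁ λ ())) ,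
    sym (trans (unorderedDinv-< p q +[1+ k ] +[1+ suc k ] s t p<q)
      (pairDinv-eval +[1+ k ] +[1+ suc k ] s t (≡ᵇ-suc k) (+[1+]≟+[1+suc]+1 k) refl refl))
  rootPairCount s t (next⁺ k) (inj₂ q<p) a⁺ a⁻ b⁺ b⁻ =
    true , false , ofʸ (a⁺ (inj₂ (inj₂ (refl , ReadBefore-even (suc k) q<p)))) , ofⁿ (b⁻ (λ ()) (inj₁ λ ())) ,
    sym (trans (unorderedDinv-> p q +[1+ k ] +[1+ suc k ] s t q<p)
      (trans (pairDinv-eval +[1+ suc k ] +[1+ k ] t s (suc-≡ᵇ k) (+[1+suc]≟+[1+]+1 k) refl (+[1+]≢-[1+]+1 (suc k) k)) (ℕP.+-identityʳ _)))
  rootPairCount s t (next⁻ k) (inj₁ p<q) a⁺ a⁻ b⁺ b⁻ =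
    true , false , ofʸ (a⁺ (inj₂ (inj₂ (refl , ReadBefore-odd (suc k) p<q)))) , ofⁿ (b⁻ (λ ()) (inj₁ λ ())) ,
    trans (cong (λ b → bit b ℕ.+ 0) (<?-neg s t))
    (sym (trans (unorderedDinv-< p q -[1+ k ] -[1+ suc k ] s t p<q)
      (trans (pairDinv-eval -[1+ k ] -[1+ suc k ] s t (≡ᵇ-suc k) (≡ᵇ-refl k) refl refl) (ℕP.+-identityʳ _))))
  rootPairCount s t (next⁻ k) (inj₂ q<p) a⁺ a⁻ b⁺ b⁻ =
    false , false , ofⁿ (a⁻ (λ ()) (inj₂ (refl , ReadBefore-odd (suc k) q<p))) , ofⁿ (b⁻ (λ ()) (inj₁ λ ())) ,
    sym (trans (unorderedDinv-> p q -[1+ k ] -[1+ suc k ] s t q<p)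
      (pairDinv-eval -[1+ suc k ] -[1+ k ] t s (suc-≡ᵇ k) (-[1+suc]≟-[1+]+1 k) refl refl))
  -- The E of `q` shares block 1 with the first N of `p` and precedes the second one, so the sum
  -- root is never in I.
  rootPairCount s t next⁰ (inj₁ p<q) a⁺ a⁻ b⁺ b⁻ =
    true , false , ofʸ (a⁺ (inj₂ (inj₂ (refl , p<q)))) , ofⁿ (b⁻ (λ ()) (inj₂ (inj₁ (s≤s z≤n)))) ,
    trans (cong (λ b → bit b ℕ.+ 0) (<?-neg s t))
    (sym (trans (unorderedDinv-< p q 0ℤ (- 1ℤ) s t p<q) (ℕP.+-identityʳ _)))
  rootPairCount s t next⁰ (inj₂ q<p) a⁺ a⁻ b⁺ b⁻ =
    false , false , ofⁿ (a⁻ (λ ()) (inj₂ (refl , q<p))) , ofⁿ (b⁻ (λ ()) (inj₂ (inj₁ (s≤s z≤n)))) ,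
    sym (unorderedDinv-> p q 0ℤ (- 1ℤ) s t q<p)
  rootPairCount {x} {y} s t (far lt) p≶q a⁺ a⁻ b⁺ b⁻ =
    false , false , ofⁿ (a⁻ y≢0 (inj₁ lt′)) , ofⁿ (b⁻ y≢0 (inj₂ (inj₁ (ℕP.≤-<-trans z≤n lt′)))) , sym (value p≶q)
    where
    y≢0 : y ≢ 0ℤ
    y≢0 y≡0 with s≤s () ← subst (λ z → suc (suc (level x)) ℕ.< level z) y≡0 lt
    lt′ : level x ℕ.< level y ∸ 2
    lt′ = ℕP.∸-monoˡ-≤ 2 lt
    value : p ℕ.< q ⊎ q ℕ.< p → unorderedDinv p q x y s t ≡ 0
    value (inj₁ p<q) = trans (unorderedDinv-< p q x y s t p<q) (proj₁ (far-pairDinv x y s t lt))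
    value (inj₂ q<p) = trans (unorderedDinv-> p q x y s t q<p) (proj₂ (far-pairDinv x y s t lt))

-- Counts as sums

CountP-++ : ∀ {A : Set} {P : A → Set} {xs ys k l} → CountP P xs k → CountP P ys l → CountP P (xs ++ ys) (k ℕ.+ l)
CountP-++ c[] q = q
CountP-++ (cyes px p) q = cyes px (CountP-++ p q)
CountP-++ (cno ¬px p) q = cno ¬px (CountP-++ p q)

CountP-concatMap : ∀ {A B : Set} {P : B → Set} {f : A → List B} (h : A → ℕ) xs →
  (∀ {x} → x ∈ xs → CountP P (f x) (h x)) → CountP P (concatMap f xs) (sum (map h xs))
CountP-concatMap h [] p = c[]
CountP-concatMap h (x ∷ xs) p = CountP-++ (p (here refl)) (CountP-concatMap h xs (p ∘ there))

CountP-map : ∀ {A B : Set} {P : B → Set} {f : A → B} (h : A → ℕ) xs →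
  (∀ {x} → x ∈ xs → CountP P (f x ∷ []) (h x)) → CountP P (map f xs) (sum (map h xs))
CountP-map h [] p = c[]
CountP-map h (x ∷ xs) p = CountP-++ (p (here refl)) (CountP-map h xs (p ∘ there))

CountP-[_] : ∀ {A : Set} {P : A → Set} {x b} → Reflects (P x) b → CountP P (x ∷ []) (bit b)
CountP-[ ofʸ px ] = cyes px c[]
CountP-[ ofⁿ ¬px ] = cno ¬px c[]

sum-map-cong : ∀ {A : Set} {f g : A → ℕ} xs → (∀ {x} → x ∈ xs → f x ≡ g x) → sum (map f xs) ≡ sum (map g xs)
sum-map-cong xs f≗g = cong sum (map-cong-local (All.tabulate f≗g))

sum-map-+ : ∀ {A : Set} (f g : A → ℕ) xs → sum (map f xs) ℕ.+ sum (map g xs) ≡ sum (map (λ x → f x ℕ.+ g x) xs)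
sum-map-+ f g [] = refl
sum-map-+ f g (x ∷ xs) = trans (interchange (f x) _ (g x) _) (cong (f x ℕ.+ g x ℕ.+_) (sum-map-+ f g xs))
  where
  interchange : ∀ a b c d → (a ℕ.+ b) ℕ.+ (c ℕ.+ d) ≡ (a ℕ.+ c) ℕ.+ (b ℕ.+ d)
  interchange = solve-∀ℕ

countB≡sum : ∀ {A : Set} (f : A → Bool) xs → countB f xs ≡ sum (map (bit ∘ f) xs)
countB≡sum f [] = refl
countB≡sum f (x ∷ xs) with f x
... | true = cong suc (countB≡sum f xs)
... | false = countB≡sum f xs

countB≡sum₄ : ∀ {A : Set} (f g h k : A → Bool) xs →
  countB f xs ℕ.+ countB g xs ℕ.+ countB h xs ℕ.+ countB k xs ≡
  sum (map (λ x → bit (f x) ℕ.+ bit (g x) ℕ.+ bit (h x) ℕ.+ bit (k x)) xs)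
countB≡sum₄ f g h k xs
  rewrite countB≡sum f xs | countB≡sum g xs | countB≡sum h xs | countB≡sum k xs
        | sum-map-+ (bit ∘ f) (bit ∘ g) xs
        | sum-map-+ (λ x → bit (f x) ℕ.+ bit (g x)) (bit ∘ h) xs
  = sum-map-+ (λ x → bit (f x) ℕ.+ bit (g x) ℕ.+ bit (h x)) (bit ∘ k) xs

-- Sums over unordered pairs

pairSum : ∀ {A : Set} → (A → A → ℕ) → List A → ℕ
pairSum F [] = 0
pairSum F (x ∷ xs) = sum (map (F x) xs) ℕ.+ pairSum F xs

pairSum-map : ∀ {A B : Set} (F : B → B → ℕ) (f : A → B) xs →
  pairSum F (map f xs) ≡ pairSum (λ x y → F (f x) (f y)) xs
pairSum-map F f [] = refl
pairSum-map F f (x ∷ xs) = cong₂ ℕ._+_ (cong sum (sym (map-∘ xs))) (pairSum-map F f xs)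

-- Symmetry enters at an adjacent transposition, the one step at which two elements meet in the
-- opposite order.
pairSum-↭ : ∀ {A : Set} {F : A → A → ℕ} → (∀ x y → F x y ≡ F y x) →
  ∀ {xs ys} → xs ↭ ys → pairSum F xs ≡ pairSum F ys
pairSum-↭ F-sym _↭_.refl = refl
pairSum-↭ {F = F} F-sym (_↭_.prep x p) = cong₂ ℕ._+_ (sum-↭ (↭P.map⁺ (F x) p)) (pairSum-↭ F-sym p)
pairSum-↭ {F = F} F-sym (_↭_.swap {xs} {ys} x y p)
  rewrite F-sym x y | sum-↭ (↭P.map⁺ (F x) p) | sum-↭ (↭P.map⁺ (F y) p) | pairSum-↭ F-sym p =
  rearrange (F y x) (sum (map (F x) ys)) (sum (map (F y) ys)) (pairSum F ys)
  where
  rearrange : ∀ a b c d → (a ℕ.+ b) ℕ.+ (c ℕ.+ d) ≡ (a ℕ.+ c) ℕ.+ (b ℕ.+ d)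
  rearrange = solve-∀ℕ
pairSum-↭ F-sym (_↭_.trans p q) = trans (pairSum-↭ F-sym p) (pairSum-↭ F-sym q)

sum-pairs : ∀ (F : ℕ → ℕ → ℕ) n → sum (map (λ p → F (proj₁ p) (proj₂ p)) (pairs n)) ≡ pairSum F (oneTo n)
sum-pairs F n = go [] (oneTo n) (oneTo-sorted n) []
  where
  F₂ : ℕ × ℕ → ℕ
  F₂ p = F (proj₁ p) (proj₂ p)
  -- `pairs` filters the full list for every first component, so the elements already passed are
  -- kept as a prefix `ys`; sortedness makes the filter drop exactly `ys` and the current element.
  go : ∀ ys xs → AllPairs ℕ._<_ xs → All (λ y → All (y ℕ.<_) xs) ys →
    sum (map F₂ (concatMap (λ i → map (i ,_) (filter (i ℕ.<?_) (ys ++ xs))) xs)) ≡ pairSum F xs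
  go ys [] _ _ = refl
  go ys (x ∷ xs) (x<xs ∷ sorted) ys<xs = begin
    sum (map F₂ (map (x ,_) (filter (x ℕ.<?_) (ys ++ x ∷ xs)) ++ rest (ys ++ x ∷ xs)))
      ≡⟨ cong (λ zs → sum (map F₂ (map (x ,_) zs ++ rest (ys ++ x ∷ xs)))) above ⟩
    sum (map F₂ (map (x ,_) xs ++ rest (ys ++ x ∷ xs)))
      ≡⟨ cong sum (map-++ F₂ (map (x ,_) xs) _) ⟩
    sum (map F₂ (map (x ,_) xs) ++ map F₂ (rest (ys ++ x ∷ xs)))
      ≡⟨ sum-++ (map F₂ (map (x ,_) xs)) _ ⟩
    sum (map F₂ (map (x ,_) xs)) ℕ.+ sum (map F₂ (rest (ys ++ x ∷ xs)))
      ≡⟨ cong₂ ℕ._+_ (cong sum (sym (map-∘ xs)))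
           (cong (λ zs → sum (map F₂ (rest zs))) (sym (++-assoc ys (x ∷ []) xs))) ⟩
    sum (map (F x) xs) ℕ.+ sum (map F₂ (rest ((ys ++ x ∷ []) ++ xs)))
      ≡⟨ cong (sum (map (F x) xs) ℕ.+_) (go (ys ++ x ∷ []) xs sorted
           (AllP.++⁺ (All.map All.tail ys<xs) (x<xs ∷ []))) ⟩
    pairSum F (x ∷ xs) ∎
    where
    open ≡-Reasoning
    rest : List ℕ → List (ℕ × ℕ)
    rest zs = concatMap (λ i → map (i ,_) (filter (i ℕ.<?_) zs)) xs
    above : filter (x ℕ.<?_) (ys ++ x ∷ xs) ≡ xs
    above = trans (filter-++ (x ℕ.<?_) ys (x ∷ xs)) (cong₂ _++_
      (filter-none (x ℕ.<?_) (All.map (ℕP.<-asym ∘ All.head) ys<xs))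
      (trans (filter-reject (x ℕ.<?_) {x} {xs} (ℕP.<-irrefl refl)) (filter-all (x ℕ.<?_) x<xs)))

map-nthℕ : ∀ xs → map (nthℕ xs) (oneTo (length xs)) ≡ xs
map-nthℕ [] = refl
map-nthℕ (x ∷ xs) = trans (cong (map (nthℕ (x ∷ xs))) (oneTo-suc (length xs))) (cong (x ∷_)
  (trans (trans (sym (map-∘ (oneTo (length xs))))
    (trans (sym (map-∘ (upTo (length xs)))) (map-∘ (upTo (length xs))))) (map-nthℕ xs)))

unorderedDinv-sym : ∀ (c u : ℕ → ℤ) p q →
  unorderedDinv p q (c p) (c q) (u p) (u q) ≡ unorderedDinv q p (c q) (c p) (u q) (u p)
unorderedDinv-sym c u p q with ℕP.<-cmp p q
... | tri≈ _ refl _ = refl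
... | tri< p<q _ _ = trans (unorderedDinv-< p q (c p) (c q) (u p) (u q) p<q) (sym (unorderedDinv-> q p (c q) (c p) (u q) (u p) p<q))
... | tri> _ _ q<p = trans (unorderedDinv-> p q (c p) (c q) (u p) (u q) q<p) (sym (unorderedDinv-< q p (c q) (c p) (u q) (u p) q<p))

-- Entries, word and window of a pair (π , u)

lamAux-bound : ∀ e π → All (_≤ e ℕ.+ countB isE π) (lamAux e π)
lamAux-bound e [] = []
lamAux-bound e (N ∷ π) = ℕP.m≤m+n e _ ∷ lamAux-bound e π
lamAux-bound e (E ∷ π) = subst (λ b → All (_≤ b) (lamAux (suc e) π)) (sym (ℕP.+-suc e _)) (lamAux-bound (suc e) π)

-- The out-of-range default 0 obeys the bound as well.
nthℕ-bound : ∀ {b xs} → All (_≤ b) xs → ∀ k → nthℕ xs k ≤ b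
nthℕ-bound [] _ = z≤n
nthℕ-bound (px ∷ pxs) zero = z≤n
nthℕ-bound (px ∷ pxs) (suc zero) = px
nthℕ-bound (px ∷ pxs) (suc (suc k)) = nthℕ-bound pxs (suc k)

reverse-oneTo : ∀ n → reverse (oneTo n) ≡ map (suc n ∸_) (oneTo n)
reverse-oneTo n = trans (sym (reverse-map suc (upTo n)))
  (trans (cong (map suc) (reverse-upTo n)) (trans (go n) (map-∘ (upTo n))))
  where
  go : ∀ n → map suc (downFrom n) ≡ map (n ∸_) (upTo n)
  go zero = refl
  go (suc n) = cong (suc n ∷_) (trans (go n)
    (trans (map-∘ (upTo n)) (cong (map (suc n ∸_)) (map-upTo suc n))))

⟦⟧-lookup : ∀ {n} (u : Vec ℤ n) {j} → InRange n j → ∃[ i ] u ⟦ j ⟧ ≡ lookup u i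
⟦⟧-lookup (x Vec.∷ u) {suc zero} _ = Fin.zero , refl
⟦⟧-lookup (x Vec.∷ u) {suc (suc j)} (_ , s≤s j<n) with i , eq ← ⟦⟧-lookup u {suc j} (s≤s z≤n , j<n) = Fin.suc i , eq

module _ (n : ℕ) (π : List Step) (u : Vec ℤ n) (|E|≡n : countB isE π ≡ n) (u-perm : IsSignedPerm n u) where

  private
    c : ℕ → ℤ
    c j = mu n π (suc n ∸ j)
    u⟦_⟧ : ℕ → ℤ
    u⟦ j ⟧ = u ⟦ j ⟧
    up = oneTo n

  -- `c j` is j - λ_j, and both terms lie between 0 and `n`, λ_j because it counts E's.
  bounded : ∀ {j} → InRange n j → ∣ c j ∣ ≤ n
  bounded {j} (1≤j , j≤n) = ℕP.≤-trans (ℕP.≤-reflexive (cong ∣_∣ (ℤP.m-n≡m⊖n i l))) (ℕP.≤-trans (ℤP.∣m⊝n∣≤m⊔n i l)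
    (ℕP.⊔-lub (ℕP.≤-trans (ℕP.≤-reflexive (ℕP.m∸[m∸n]≡n (ℕP.m≤n⇒m≤1+n j≤n))) j≤n)
      (subst (l ≤_) |E|≡n (nthℕ-bound (lamAux-bound 0 π) i))))
    where
    i = suc n ∸ (suc n ∸ j)
    l = nthℕ (lam π) i

  -- Since μ_i is `c (suc n ∸ i)`, reading μ from left to right is reading `c` from right to left.
  muList≡ : muList n π ≡ map c (reverse up)
  muList≡ = sym (trans (cong (map c) (reverse-oneTo n)) (trans (sym (map-∘ up))
    (map-cong-local (All.tabulate λ i∈ → cong (mu n π) (ℕP.m∸[m∸n]≡n (ℕP.m≤n⇒m≤1+n (proj₂ (∈-oneTo⁻ i∈))))))))

  zetaC≡ : zetaC n π ≡ map proj₁ (zetaWord n c n)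
  zetaC≡ = sym (map-proj₁-zetaWord n c muList≡ n)

  windowEntry : ℕ → ℤ
  windowEntry j = signed (c j) u⟦ j ⟧

  dC≡ : dC n π u ≡ map windowEntry (windowLabels n c)
  dC≡ = trans (concatMap-cong blocks (upTo (suc n))) (sym (map-concatMap windowEntry (windowBlock n c) (upTo (suc n))))
    where
    signed-neg : ∀ i s → signed (- (+ i)) s ≡ - s
    signed-neg zero s = refl
    signed-neg (suc i) s = refl
    -- The `_` is the local `block` of `dC`, solved from the use of `blocks` in `concatMap-cong`.
    blocks : ∀ i → _ ≡ map windowEntry (windowBlock n c i)
    blocks i = sym (trans (map-++ windowEntry (level-set n c (- (+ i)) (reverse up)) _) (cong₂ _++_
      (map-cong-local (All.map (λ {j} c≡ → trans (cong (λ x → signed x u⟦ j ⟧) c≡) (signed-neg i u⟦ j ⟧)) (AllP.all-filter (λ j → c j ℤ.≟ - (+ i)) (reverse up))))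
      (map-cong-local (All.map (λ {j} c≡ → cong (λ x → signed x u⟦ j ⟧) c≡) (AllP.all-filter (λ j → c j ℤ.≟ + suc i) up)))))

  private
    ℓ : ℕ → ℕ
    ℓ = label n c bounded

  nthℤ-dC : ∀ {a} → InRange n a → nthℤ (dC n π u) a ≡ windowEntry (ℓ a)
  nthℤ-dC {suc a} a∈ = trans (cong (λ w → nthℤ w (suc a)) dC≡)
    ([]≡⇒nthℤ ([]≡-map⁺ windowEntry (label-at n c bounded a∈)))

  windowEntry-signed : ∀ {j} → InRange n j → SignedIndex n (windowEntry j)
  windowEntry-signed {j} j∈ with i , eq ← ⟦⟧-lookup u j∈ with c j | subst (SignedIndex n) (sym eq) (proj₁ u-perm i)
  ... | + zero   | signed-u = SignedIndex-neg signed-u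
  ... | +[1+ _ ] | signed-u = signed-u
  ... | -[1+ _ ] | signed-u = SignedIndex-neg signed-u

  private
    Counted : Vec ℤ n → Set
    Counted x = InI n (zetaC n π) x × act n (dC n π u) x ∈ posRoots n

  module _ {a b} (a∈ : InRange n a) (b∈ : InRange n b) where

    private
      va = windowEntry (ℓ a)
      vb = windowEntry (ℓ b)
      va-signed = windowEntry-signed (label-range n c bounded a∈)
      vb-signed = windowEntry-signed (label-range n c bounded b∈)

    act-diff-reflects : Reflects (act n (dC n π u) (e n b ⊖ e n a) ∈ posRoots n) (does (va ℤ.<? vb))
    act-diff-reflects rewrite act-diff (dC n π u) a∈ b∈ | nthℤ-dC a∈ | nthℤ-dC b∈ with va ℤ.<? vb
    ... | yes va<vb = ofʸ (eS-diff∈posRoots vb-signed va-signed va<vb)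
    ... | no va≮vb = ofⁿ (eS-diff∉posRoots vb-signed va-signed (ℤP.≮⇒≥ va≮vb))

    act-sum-reflects : Reflects (act n (dC n π u) (e n a ⊕ e n b) ∈ posRoots n) (does (- vb ℤ.<? va))
    act-sum-reflects rewrite act-sum (dC n π u) a∈ b∈ | nthℤ-dC a∈ | nthℤ-dC b∈
      | eS-sum≡diff {n} {va} {vb} vb-signed with - vb ℤ.<? va
    ... | yes lt = ofʸ (eS-diff∈posRoots va-signed (SignedIndex-neg vb-signed) lt)
    ... | no ≮ = ofⁿ (eS-diff∉posRoots va-signed (SignedIndex-neg vb-signed) (ℤP.≮⇒≥ ≮))

  pairCount : ℕ → ℕ → ℕ
  pairCount p q = unorderedDinv p q (c p) (c q) u⟦ p ⟧ u⟦ q ⟧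

  count-pair : ∀ {a b} → 1 ≤ a → a ℕ.< b → b ≤ n →
    CountP Counted ((e n b ⊖ e n a) ∷ (e n a ⊕ e n b) ∷ []) (pairCount (ℓ a) (ℓ b))
  count-pair {a} {b} 1≤a a<b b≤n = count result
    where
    a∈ = proj₁ (range-< 1≤a a<b b≤n)
    b∈ = proj₂ (range-< 1≤a a<b b≤n)
    p = ℓ a
    q = ℓ b
    InI-zeta : Vec ℤ n → Set
    InI-zeta = InI n (zetaC n π)
    zeta⁺ : ∀ {x} → InI n (map proj₁ (zetaWord n c n)) x → InI-zeta x
    zeta⁺ {x} = subst (λ β → InI n β x) (sym zetaC≡)
    zeta⁻ : ∀ {x} → ¬ InI n (map proj₁ (zetaWord n c n)) x → ¬ InI-zeta x
    zeta⁻ {x} = subst (λ β → ¬ InI n β x) (sym zetaC≡)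
    q≺p : nKey n c q ≺ nKey n c p
    q≺p = label-order n c bounded 1≤a b≤n a<b
    p≶q : p ℕ.< q ⊎ q ℕ.< p
    p≶q with ℕP.<-cmp p q
    ... | tri< lt _ _ = inj₁ lt
    ... | tri> _ _ gt = inj₂ gt
    -- Different positions carry different indices, since their keys are strictly ordered.
    ... | tri≈ _ p≡q _ = ⊥-elim (≺-irrefl (subst (λ r → nKey n c r ≺ nKey n c p) (sym p≡q) q≺p))
    result : RootPairCount {InI-zeta (e n b ⊖ e n a)} {InI-zeta (e n a ⊕ e n b)} p q (c p) (c q) u⟦ p ⟧ u⟦ q ⟧
    result = rootPairCount p q u⟦ p ⟧ u⟦ q ⟧ (config p q (c p) (c q) q≺p) p≶q
      (zeta⁺ ∘ diff∈I n c bounded 1≤a b≤n a<b)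
      (λ cq≢0 → zeta⁻ ∘ diff∉I n c bounded 1≤a b≤n a<b cq≢0)
      (λ cp≡0 → zeta⁺ ∘ sum∈I n c bounded 1≤a b≤n (ℕP.<⇒≤ a<b) cp≡0)
      (λ cq≢0 → zeta⁻ ∘ sum∉I n c bounded 1≤a b≤n (ℕP.<⇒≤ a<b) cq≢0)
    count : RootPairCount {InI-zeta (e n b ⊖ e n a)} {InI-zeta (e n a ⊕ e n b)} p q (c p) (c q) u⟦ p ⟧ u⟦ q ⟧ →
      CountP Counted ((e n b ⊖ e n a) ∷ (e n a ⊕ e n b) ∷ []) (pairCount p q)
    count (_ , _ , diff-reflects , sum-reflects , total) = subst (CountP Counted _) total (CountP-++
      CountP-[ diff-reflects ×-reflects act-diff-reflects a∈ b∈ ]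
      CountP-[ sum-reflects ×-reflects act-sum-reflects a∈ b∈ ])

  diagonalCount : ℕ → ℕ
  diagonalCount j = bit (does (c j ℤ.≟ + 0) ∧ does (u⟦ j ⟧ ℤ.<? + 0))

  -- Here both letters belong to the same index: it has either an E or a second N, so 2 e a lies in
  -- I iff the entry is 0. The window then holds -u(p), positive iff u(p) < 0.
  count-diagonal : ∀ {a} → InRange n a → CountP Counted ((+ 2) • e n a ∷ []) (diagonalCount (ℓ a))
  count-diagonal {a} a∈@(1≤a , a≤n) = CountP-[ counted-reflects ]
    where
    p = ℓ a
    p-signed = windowEntry-signed (label-range n c bounded a∈)
    double≡ : e n a ⊕ e n a ≡ (+ 2) • e n a
    double≡ = sym (x⊕x≡2•x (e n a))
    act-double≡ : act n (dC n π u) ((+ 2) • e n a) ≡ (+ 2) • eS n (windowEntry p)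
    act-double≡ = trans (act-double (dC n π u) a∈) (cong (λ v → (+ 2) • eS n v) (nthℤ-dC a∈))
    counted-reflects : Reflects (Counted ((+ 2) • e n a)) (does (c p ℤ.≟ + 0) ∧ does (u⟦ p ⟧ ℤ.<? + 0))
    counted-reflects with c p ℤ.≟ + 0
    ... | no cp≢0 = ofⁿ λ (x∈I , _) → sum∉I n c bounded 1≤a a≤n ℕP.≤-refl cp≢0 (inj₁ cp≢0)
      (subst₂ (InI n) zetaC≡ (sym double≡) x∈I)
    ... | yes cp≡0 = ofʸ (subst₂ (InI n) (sym zetaC≡) double≡ (sum∈I n c bounded 1≤a a≤n ℕP.≤-refl cp≡0 (inj₁ cp≡0)))
          ×-reflects act-reflects
      where
      entry≡ : windowEntry p ≡ - u⟦ p ⟧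
      entry≡ = cong (λ x → signed x u⟦ p ⟧) cp≡0
      act-reflects : Reflects (act n (dC n π u) ((+ 2) • e n a) ∈ posRoots n) (does (u⟦ p ⟧ ℤ.<? + 0))
      act-reflects rewrite act-double≡ with u⟦ p ⟧ ℤ.<? + 0
      ... | yes u<0 = ofʸ (eS-double∈posRoots p-signed (subst (0ℤ ℤ.<_) (sym entry≡) (ℤP.neg-mono-< u<0)))
      ... | no u≮0 = ofⁿ (eS-double∉posRoots p-signed (subst (ℤ._≤ 0ℤ) (sym entry≡) (ℤP.neg-mono-≤ (ℤP.≮⇒≥ u≮0))))

  map-ℓ : map ℓ up ≡ windowLabels n c
  map-ℓ = subst (λ m → map ℓ (oneTo m) ≡ windowLabels n c) (length-windowLabels n c bounded) (map-nthℕ (windowLabels n c))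

  -- Passes from pairs of window positions to pairs of indices: both are sums over unordered pairs,
  -- of lists that are permutations of each other.
  pair-total : sum (map (λ ab → pairCount (ℓ (proj₁ ab)) (ℓ (proj₂ ab))) (pairs n)) ≡
    sum (map (λ ij → pairCount (proj₁ ij) (proj₂ ij)) (pairs n))
  pair-total = begin
    sum (map (λ ab → pairCount (ℓ (proj₁ ab)) (ℓ (proj₂ ab))) (pairs n)) ≡⟨ sum-pairs (λ a b → pairCount (ℓ a) (ℓ b)) n ⟩
    pairSum (λ a b → pairCount (ℓ a) (ℓ b)) up     ≡⟨ pairSum-map pairCount ℓ up ⟨
    pairSum pairCount (map ℓ up)                   ≡⟨ cong (pairSum pairCount) map-ℓ ⟩
    pairSum pairCount (windowLabels n c)           ≡⟨ pairSum-↭ (unorderedDinv-sym c u⟦_⟧) (windowLabels↭oneTo n c bounded) ⟩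
    pairSum pairCount up                           ≡⟨ sum-pairs pairCount n ⟨
    sum (map (λ ij → pairCount (proj₁ ij) (proj₂ ij)) (pairs n)) ∎
    where open ≡-Reasoning

  diagonal-total : sum (map (diagonalCount ∘ ℓ) up) ≡ sum (map diagonalCount up)
  diagonal-total = trans (cong sum (trans (map-∘ up) (cong (map diagonalCount) map-ℓ)))
    (sum-↭ (↭P.map⁺ diagonalCount (windowLabels↭oneTo n c bounded)))

  dinv≡ : dinv'C n π u ≡
    sum (map (λ ij → pairCount (proj₁ ij) (proj₂ ij)) (pairs n)) ℕ.+ sum (map diagonalCount up)
  dinv≡ = cong₂ ℕ._+_
    (trans (countB≡sum₄ _ _ _ _ (pairs n)) (sum-map-cong (pairs n) λ {ij} ij∈ →
      sym (unorderedDinv-< (proj₁ ij) (proj₂ ij) (c (proj₁ ij)) (c (proj₂ ij)) u⟦ proj₁ ij ⟧ u⟦ proj₂ ij ⟧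
        (proj₁ (proj₂ (∈-pairs⁻ {n} ij∈))))))
    (countB≡sum _ up)

  area-is-dinv : AreaIs n (zetaC n π) (dC n π u) (dinv'C n π u)
  area-is-dinv = subst (CountP Counted (posRoots n))
    (trans (cong₂ ℕ._+_ pair-total diagonal-total) (sym dinv≡))
    (CountP-++
      (CountP-concatMap (λ ab → pairCount (ℓ (proj₁ ab)) (ℓ (proj₂ ab))) (pairs n)
        λ ab∈ → let 1≤a , a<b , b≤n = ∈-pairs⁻ {n} ab∈ in count-pair 1≤a a<b b≤n)
      (CountP-map (diagonalCount ∘ ℓ) up (count-diagonal ∘ ∈-oneTo⁻)))

theorem4p29 : (n : ℕ) → 1 ≤ n → (π : List Step) → (u : Vec ℤ n) →
    InVert n π u → AreaIs n (zetaC n π) (dC n π u) (dinv'C n π u)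
theorem4p29 n _ π u ((_ , |E|≡n) , u-perm , _) = area-is-dinv n π u |E|≡n u-perm
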